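{- Let $\|\cdot\|$ be any norm on $\mathbb{R}^2$. Then there exists a strong crescent configuration of size $4$ in $\|\cdot\|$.
   Context: A $\|\cdot\|$ circle is a set $\{q\in\mathbb{R}^2:\|q-p\|=r\}$ with $p\in\mathbb{R}^2$, $r>0$. A set $S\subset\mathbb{R}^2$ of $n$ points is a line-like configuration of size $n$ in $\|\cdot\|$ if its distance graph is isomorphic to that of $n$ equally spaced points on a line, i.e. there is a bijection $\phi: S\to\{1,\dots,n\}$ such that for all $a,b,c,d\in S$: $\|a-b\|=\|c-d\|$ if and only if $|\phi(a)-\phi(b)|=|\phi(c)-\phi(d)|$. A set of points lies in strong general position in $\|\cdot\|$ if (1) no three of its points lie on a common line, (2) no four of its points lie on a common $\|\cdot\|$ circle, and (3) no four of its points form a line-like configuration of size four in $\|\cdot\|$. A set of $n$ points in $\mathbb{R}^2$ is a strong crescent configuration of size $n$ in $\|\cdot\|$ if (1) it lies in strong general position in $\|\cdot\|$, (2) it determines exactly $n-1$ distinct (nonzero) distances, measured in $\|\cdot\|$, and (3) for each $1\leq i\leq n-1$ there is a distance which occurs with multiplicity exactly $i$ among the unordered pairs of distinct points. -}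

module Defs where

open import Algebra.Bundles using (CommutativeRing)
open import Algebra.Module.Bundles using (Module)
import Algebra.Module.Construct.DirectProduct as DirectProduct
import Algebra.Module.Construct.TensorUnit as TensorUnit
open import Data.Fin.Base as Fin using (Fin; toℕ)
open import Data.Fin.Permutation using (Permutation′; _⟨$⟩ʳ_)
open import Data.List.Base using (List; length)
import Data.List.Membership.Setoid as Membership
import Data.List.Relation.Unary.Unique.Setoid as UniqueSetoid
open import Data.Nat.Base as ℕ using (ℕ; ∣_-_∣)
open import Data.Product.Base using (_×_; _,_; ∃-syntax)
open import Data.Sum.Base using ([_,_]′)
open import Function.Base using (_∘_; const)
open import Function.Bundles using (_⇔_)
open import Function.Definitions using (Injective)
open import Level using (0ℓ; suc)
open import Relation.Binary.Bundles using (Setoid)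
open import Relation.Binary.Core using (Rel)
open import Relation.Binary.PropositionalEquality.Core using (_≡_)
import Relation.Binary.PropositionalEquality.Properties as ≡
open import Relation.Binary.Structures using (IsTotalOrder)
open import Relation.Nullary.Negation.Core using (¬_)
open import Relation.Unary using (Pred)

HasCardinality : (A : Setoid 0ℓ 0ℓ) → Pred (Setoid.Carrier A) 0ℓ → ℕ → Set
HasCardinality A P n =
  ∃[ xs ] Unique xs × length xs ≡ n × (∀ x → x ∈ xs ⇔ P x)
  where
  open Membership A using (_∈_)
  open UniqueSetoid A using (Unique)

-- The library has no real numbers.  Classically ℝ is the Dedekind-complete
-- ordered field, unique up to isomorphism, so results about ℝ are stated for
-- an arbitrary model of these axioms.  The usual theory of ℝ is classical:
-- excluded middle is meant to be assumed alongside a model.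
record CompleteOrderedField : Set (suc 0ℓ) where
  field
    commutativeRing : CommutativeRing 0ℓ 0ℓ

  open CommutativeRing commutativeRing public

  infix 4 _≤_ _<_

  field
    _≤_          : Rel Carrier 0ℓ
    isTotalOrder : IsTotalOrder _≈_ _≤_
    0≉1          : ¬ 0# ≈ 1#
    inverse      : ∀ x → ¬ x ≈ 0# → ∃[ y ] x * y ≈ 1#
    +-monoˡ-≤    : ∀ z {x y} → x ≤ y → x + z ≤ y + z
    *-nonNeg     : ∀ {x y} → 0# ≤ x → 0# ≤ y → 0# ≤ x * y

  open IsTotalOrder isTotalOrder public
    using (total; antisym)
    renaming (refl to ≤-refl; reflexive to ≤-reflexive; trans to ≤-trans)

  _<_ : Rel Carrier 0ℓ
  x < y = x ≤ y × ¬ x ≈ y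

  UpperBound : Pred Carrier 0ℓ → Pred Carrier 0ℓ
  UpperBound P b = ∀ x → P x → x ≤ b

  field
    supremum : (P : Pred Carrier 0ℓ) → ∃[ x ] P x → ∃[ b ] UpperBound P b →
               ∃[ s ] UpperBound P s × (∀ b → UpperBound P b → s ≤ b)

  abs : Carrier → Carrier
  abs x = [ const x , const (- x) ]′ (total 0# x)

module Plane (ℝ : CompleteOrderedField) where
  open CompleteOrderedField ℝ

  ℝ² : Module commutativeRing 0ℓ 0ℓ
  ℝ² = DirectProduct.⟨module⟩ TensorUnit.⟨module⟩ TensorUnit.⟨module⟩

  open Module ℝ² public
    using (_≈ᴹ_; _+ᴹ_; -ᴹ_; _*ₗ_; 0ᴹ) renaming (Carrierᴹ to Point)

  infixl 6 _-ᴹ_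

  _-ᴹ_ : Point → Point → Point
  p -ᴹ q = p +ᴹ (-ᴹ q)

  record Norm : Set where
    field
      ‖_‖         : Point → Carrier
      cong        : ∀ {p q} → p ≈ᴹ q → ‖ p ‖ ≈ ‖ q ‖
      nonNegative : ∀ p → 0# ≤ ‖ p ‖
      definite    : ∀ p → ‖ p ‖ ≈ 0# → p ≈ᴹ 0ᴹ
      homogeneous : ∀ a p → ‖ a *ₗ p ‖ ≈ abs a * ‖ p ‖
      triangle    : ∀ p q → ‖ p +ᴹ q ‖ ≤ ‖ p ‖ + ‖ q ‖

  -- A set of n points is given by an enumeration q : Fin n → Point, injective
  -- up to _≈ᴹ_ where the points have to be distinct.
  Distinct : ∀ {n} → (Fin n → Point) → Set
  Distinct q = Injective _≡_ _≈ᴹ_ q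

  Collinear : ∀ {n} → (Fin n → Point) → Set
  Collinear q =
    ∃[ p ] ∃[ v ] ¬ v ≈ᴹ 0ᴹ × (∀ i → ∃[ t ] q i ≈ᴹ p +ᴹ t *ₗ v)

  NoSubfamily : ∀ {n} k → ((Fin k → Point) → Set) → (Fin n → Point) → Set
  NoSubfamily {n} k P q =
    (ι : Fin k → Fin n) → Injective _≡_ _≡_ ι → ¬ P (q ∘ ι)

  module Configurations (N : Norm) where
    open Norm N

    dist : Point → Point → Carrier
    dist p q = ‖ p -ᴹ q ‖

    Concyclic : ∀ {n} → (Fin n → Point) → Set
    Concyclic q = ∃[ p ] ∃[ r ] 0# < r × (∀ i → dist (q i) p ≈ r)

    -- The labels are 0, …, n - 1 instead of 1, …, n, which leaves their
    -- differences unchanged.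
    LineLike : ∀ {n} → (Fin n → Point) → Set
    LineLike {n} q = Distinct q × (∃[ φ ] PreservesDistances φ)
      where
      PreservesDistances : Permutation′ n → Set
      PreservesDistances φ = ∀ a b c d →
        dist (q a) (q b) ≈ dist (q c) (q d) ⇔
        ∣ toℕ (φ ⟨$⟩ʳ a) - toℕ (φ ⟨$⟩ʳ b) ∣ ≡
        ∣ toℕ (φ ⟨$⟩ʳ c) - toℕ (φ ⟨$⟩ʳ d) ∣

    record StrongGeneralPosition {n} (q : Fin n → Point) : Set where
      field
        noThreeCollinear : NoSubfamily 3 Collinear q
        noFourConcyclic  : NoSubfamily 4 Concyclic q
        noFourLineLike   : NoSubfamily 4 LineLike q

    -- Unordered pairs of distinct points are index pairs with i < j.
    PairAtDistance : ∀ {n} → (Fin n → Point) → Carrier → Pred (Fin n × Fin n) 0ℓ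
    PairAtDistance q d (i , j) = i Fin.< j × dist (q i) (q j) ≈ d

    Determines : ∀ {n} → (Fin n → Point) → Pred Carrier 0ℓ
    Determines q d = ∃[ ij ] PairAtDistance q d ij

    Multiplicity : ∀ {n} → (Fin n → Point) → Carrier → ℕ → Set
    Multiplicity {n} q d =
      HasCardinality (≡.setoid (Fin n × Fin n)) (PairAtDistance q d)

    record StrongCrescent {n} (q : Fin n → Point) : Set where
      field
        distinct              : Distinct q
        strongGeneralPosition : StrongGeneralPosition q
        distances             : HasCardinality setoid (Determines q) (n ℕ.∸ 1)
        multiplicities        : ∀ i → 1 ℕ.≤ i → i ℕ.≤ n ℕ.∸ 1 →
                                ∃[ d ] Multiplicity q d i

{-# OPTIONS --safe #-}
module Submission where

-- The points are the vertices of an equilateral triangle together with a point d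
-- in its interior that is equidistant from two vertices and closer to the third.
-- Since d is interior, no three of the points are collinear and no circle passes
-- through all four: pushing d slightly away from the centre of the circle leaves
-- it in the triangle, hence in the disc.  The equilateral triangle excludes a
-- line-like configuration.
--
-- The triangle exists by the intermediate value theorem, and so does d, on the
-- segment parallel to a side and three times shorter, near the opposite vertex:
-- there d has distance at most 1/3 of a side from that vertex, hence at least 2/3
-- from the other two.  The zero could be an endpoint of the segment only if the
-- unit circle contains a segment that is too long, and this cannot happen at all
-- three vertices.

open import Defs
open import Axiom.ExcludedMiddle using (ExcludedMiddle)
open import Data.Fin.Base using (Fin)
open import Data.Product.Base using (Σ-syntax)
open import Level using (0ℓ)

open import Algebra.Bundles using (CommutativeRing)
import Algebra.Properties.CommutativeMonoid.Sum as Sum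
import Algebra.Properties.Ring as RingProperties
import Algebra.Properties.Semiring.Mult.TCOptimised as Multiplication
import Algebra.Solver.Ring as RingSolver
open import Algebra.Solver.Ring.AlmostCommutativeRing using (fromCommutativeRing; _-Raw-AlmostCommutative⟶_)
open import Data.Empty using (⊥-elim)
open import Data.Fin.Base as Fin using (suc; toℕ; punchOut)
open import Data.Fin.Patterns using (0F; 1F; 2F; 3F)
open import Data.Fin.Permutation using (_⟨$⟩ʳ_)
open import Data.Fin.Properties as Fin using (all?; any?; ¬∀⟶∃¬; injective⇒≤; punchOut-injective)
open import Data.Integer.Base as ℤ using (ℤ; +_; -[1+_])
import Data.Integer.Properties as ℤ
open import Data.List.Base using (List; length; filter; cartesianProduct; allFin; tabulate)
open import Data.List.Membership.Propositional.Properties using (∈-filter⁺; ∈-filter⁻; ∈-cartesianProduct⁺; ∈-allFin)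
import Data.List.Membership.Setoid.Properties as Membership
open import Data.List.Properties using (length-tabulate)
import Data.List.Relation.Unary.Unique.Propositional.Properties as Unique
import Data.List.Relation.Unary.Unique.Setoid.Properties as UniqueSetoid
import Data.Maybe.Base as Maybe
open import Data.Nat.Base as ℕ using (ℕ; ∣_-_∣; s≤s; z≤n)
import Data.Nat.Properties as ℕ
open import Data.Product.Base using (∃-syntax; ∃₂; _×_; _,_; proj₁; proj₂)
open import Data.Sum.Base using (inj₁; inj₂; [_,_]′)
open import Data.Vec.Functional using (removeAt; replicate)
open import Function.Base using (_∘_)
open import Function.Bundles using (mk⇔; Equivalence; Injection)
open import Function.Definitions using (Injective)
open import Function.Properties.Inverse using (↔⇒↣)
open import Relation.Binary.Definitions using (tri<; tri≈; tri>)
open import Relation.Binary.PropositionalEquality.Core as ≡ using (_≡_; _≢_)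
import Relation.Binary.Reasoning.Setoid as SetoidReasoning
open import Relation.Nullary.Decidable.Core using (yes; no; dec⇒maybe; from-yes; _×-dec_; _→-dec_)
open import Relation.Nullary.Negation.Core using (¬_)
open import Relation.Unary using (Decidable)

-- Ordered fields

-- Equality in the ring need not be decidable, so the solver takes its coefficients from ℤ along the
-- canonical homomorphism. With the optimised multiples, `con (+ 3)` evaluates to `1# + 1# + 1#`,
-- which lets solved identities match `3#` definitionally.
module IntegerCoefficients {c ℓ} (R : CommutativeRing c ℓ) where
  open CommutativeRing R
  open RingProperties ring
  open Multiplication semiring using (×-homo-+; ×1-homo-*; 1+×) renaming (_×_ to _×′_)
  open SetoidReasoning setoid

  private
    ⟦_⟧ : ℤ → Carrier
    ⟦ + n ⟧      = n ×′ 1#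
    ⟦ -[1+ n ] ⟧ = - (ℕ.suc n ×′ 1#)

    ⊖-homo : ∀ m n → ⟦ m ℤ.⊖ n ⟧ ≈ m ×′ 1# - n ×′ 1#
    ⊖-homo m ℕ.zero = begin
      m ×′ 1#           ≈⟨ +-identityʳ _ ⟨
      m ×′ 1# + 0#      ≈⟨ +-congˡ -0#≈0# ⟨
      m ×′ 1# - 0#      ∎
    ⊖-homo ℕ.zero (ℕ.suc n) = sym (+-identityˡ _)
    ⊖-homo (ℕ.suc m) (ℕ.suc n) = begin
      ⟦ ℕ.suc m ℤ.⊖ ℕ.suc n ⟧              ≡⟨ ≡.cong ⟦_⟧ (ℤ.[1+m]⊖[1+n]≡m⊖n m n) ⟩
      ⟦ m ℤ.⊖ n ⟧                          ≈⟨ ⊖-homo m n ⟩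
      a - b                                ≈⟨ +-congʳ (+-identityˡ a) ⟨
      -- Inserting 1 - 1 lets each of the two numerals absorb its own 1.
      0# + a - b                           ≈⟨ +-congʳ (+-congʳ (-‿inverseʳ 1#)) ⟨
      1# - 1# + a - b                      ≈⟨ +-congʳ (+-assoc 1# (- 1#) a) ⟩
      1# + (- 1# + a) - b                  ≈⟨ +-congʳ (+-congˡ (+-comm (- 1#) a)) ⟩
      1# + (a - 1#) - b                    ≈⟨ +-congʳ (+-assoc 1# a (- 1#)) ⟨
      1# + a - 1# - b                      ≈⟨ +-assoc (1# + a) (- 1#) (- b) ⟩
      1# + a + (- 1# - b)                  ≈⟨ +-congˡ (-‿+-comm 1# b) ⟩
      1# + a - (1# + b)                    ≈⟨ +-cong (1+× m 1#) (-‿cong (1+× n 1#)) ⟨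
      ℕ.suc m ×′ 1# - ℕ.suc n ×′ 1#        ∎
      where a = m ×′ 1#
            b = n ×′ 1#

    -‿homo : ∀ i → ⟦ ℤ.- i ⟧ ≈ - ⟦ i ⟧
    -‿homo (+ ℕ.zero)    = sym -0#≈0#
    -‿homo (+ ℕ.suc n)   = refl
    -‿homo -[1+ n ]      = sym (-‿involutive _)

    +-homo : ∀ i j → ⟦ i ℤ.+ j ⟧ ≈ ⟦ i ⟧ + ⟦ j ⟧
    +-homo (+ m)    (+ n)    = ×-homo-+ 1# m n
    +-homo (+ m)    -[1+ n ] = ⊖-homo m (ℕ.suc n)
    +-homo -[1+ m ] (+ n)    = trans (⊖-homo n (ℕ.suc m)) (+-comm _ _)
    +-homo -[1+ m ] -[1+ n ] = begin
      ⟦ -[1+ m ] ℤ.+ -[1+ n ] ⟧            ≡⟨ ≡.cong ⟦_⟧ (ℤ.neg-distrib-+ (+ ℕ.suc m) (+ ℕ.suc n)) ⟨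
      - ((ℕ.suc m ℕ.+ ℕ.suc n) ×′ 1#)      ≈⟨ -‿cong (×-homo-+ 1# (ℕ.suc m) (ℕ.suc n)) ⟩
      - (ℕ.suc m ×′ 1# + ℕ.suc n ×′ 1#)    ≈⟨ -‿+-comm _ _ ⟨
      - (ℕ.suc m ×′ 1#) - ℕ.suc n ×′ 1#    ∎

    +*+-homo : ∀ m n → ⟦ + m ℤ.* + n ⟧ ≈ ⟦ + m ⟧ * ⟦ + n ⟧
    +*+-homo m n = begin
      ⟦ + m ℤ.* + n ⟧      ≡⟨ ≡.cong ⟦_⟧ (ℤ.pos-* m n) ⟨
      ⟦ + (m ℕ.* n) ⟧      ≈⟨ ×1-homo-* m n ⟩
      ⟦ + m ⟧ * ⟦ + n ⟧    ∎

    +*-homo : ∀ m j → ⟦ + m ℤ.* j ⟧ ≈ ⟦ + m ⟧ * ⟦ j ⟧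
    +*-homo m (+ n)    = +*+-homo m n
    +*-homo m -[1+ n ] = begin
      ⟦ + m ℤ.* -[1+ n ] ⟧             ≡⟨ ≡.cong ⟦_⟧ (ℤ.neg-distribʳ-* (+ m) (+ ℕ.suc n)) ⟨
      ⟦ ℤ.- (+ m ℤ.* + ℕ.suc n) ⟧      ≈⟨ -‿homo (+ m ℤ.* + ℕ.suc n) ⟩
      - ⟦ + m ℤ.* + ℕ.suc n ⟧          ≈⟨ -‿cong (+*+-homo m (ℕ.suc n)) ⟩
      - (⟦ + m ⟧ * ⟦ + ℕ.suc n ⟧)      ≈⟨ -‿distribʳ-* _ _ ⟩
      ⟦ + m ⟧ * ⟦ -[1+ n ] ⟧           ∎

    *-homo : ∀ i j → ⟦ i ℤ.* j ⟧ ≈ ⟦ i ⟧ * ⟦ j ⟧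
    *-homo (+ m)    j = +*-homo m j
    *-homo -[1+ m ] j = begin
      ⟦ -[1+ m ] ℤ.* j ⟧           ≡⟨ ≡.cong ⟦_⟧ (ℤ.neg-distribˡ-* (+ ℕ.suc m) j) ⟨
      ⟦ ℤ.- (+ ℕ.suc m ℤ.* j) ⟧    ≈⟨ -‿homo (+ ℕ.suc m ℤ.* j) ⟩
      - ⟦ + ℕ.suc m ℤ.* j ⟧        ≈⟨ -‿cong (+*-homo (ℕ.suc m) j) ⟩
      - (⟦ + ℕ.suc m ⟧ * ⟦ j ⟧)    ≈⟨ -‿distribˡ-* _ _ ⟩
      ⟦ -[1+ m ] ⟧ * ⟦ j ⟧         ∎

    homomorphism : CommutativeRing.rawRing ℤ.+-*-commutativeRing -Raw-AlmostCommutative⟶ fromCommutativeRing R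
    homomorphism = record
      { ⟦_⟧ = ⟦_⟧ ; +-homo = +-homo ; *-homo = *-homo ; -‿homo = -‿homo
      ; 0-homo = refl ; 1-homo = refl }

  open RingSolver _ _ homomorphism
    (λ i j → Maybe.map (λ i≡j → reflexive (≡.cong ⟦_⟧ i≡j)) (dec⇒maybe (i ℤ.≟ j))) public

module OrderedField (ℝ : CompleteOrderedField) where
  open CompleteOrderedField ℝ public
  open IntegerCoefficients commutativeRing public
    using (solve; _:=_; _:+_; _:*_; _:-_; :-_; con)
  open SetoidReasoning setoid

  2# 3# : Carrier
  2# = 1# + 1#
  3# = 1# + 1# + 1#

  ≤-resp-≈ : ∀ {x x′ y y′} → x ≈ x′ → y ≈ y′ → x ≤ y → x′ ≤ y′
  ≤-resp-≈ x≈x′ y≈y′ x≤y = ≤-trans (≤-reflexive (sym x≈x′)) (≤-trans x≤y (≤-reflexive y≈y′))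

  -- The equation says y - x ≈ r - l.
  ≤-by : ∀ {l r x y} → l ≤ r → y + l ≈ x + r → x ≤ y
  ≤-by {l} {r} {x} {y} l≤r eq = ≤-resp-≈ e₁ e₂ (+-monoˡ-≤ (x - l) l≤r)
    where
    e₁ : l + (x - l) ≈ x
    e₁ = solve 2 (λ l x → l :+ (x :- l) := x) refl l x
    e₂ : r + (x - l) ≈ y
    e₂ = begin
      r + (x - l)  ≈⟨ solve 3 (λ l x r → r :+ (x :- l) := (x :+ r) :- l) refl l x r ⟩
      x + r - l    ≈⟨ +-congʳ eq ⟨
      y + l - l    ≈⟨ solve 2 (λ l y → (y :+ l) :- l := y) refl l y ⟩
      y            ∎

  infixl 6 _⟨+⟩_

  -- With `≤-by` this does linear arithmetic: the hypotheses are added up, and the solver checks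
  -- that their sum is the goal. Norms that the goal does not mention cancel.
  _⟨+⟩_ : ∀ {x y z w} → x ≤ y → z ≤ w → x + z ≤ y + w
  _⟨+⟩_ {x} {y} {z} {w} x≤y z≤w = ≤-trans (+-monoˡ-≤ z x≤y)
    (≤-resp-≈ (+-comm z y) (+-comm w y) (+-monoˡ-≤ y z≤w))

  ≤⇒0≤- : ∀ {x y} → x ≤ y → 0# ≤ y - x
  ≤⇒0≤- {x} {y} p = ≤-by p (solve 2 (λ x y → (y :- x) :+ x := con (+ 0) :+ y) refl x y)

  *-monoˡ-≤ : ∀ {k x y} → 0# ≤ k → x ≤ y → k * x ≤ k * y
  *-monoˡ-≤ {k} {x} {y} 0≤k x≤y = ≤-by (*-nonNeg 0≤k (≤⇒0≤- x≤y))
    (solve 3 (λ k x y → k :* y :+ con (+ 0) := k :* x :+ k :* (y :- x)) refl k x y)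

  *-monoʳ-≤ : ∀ {k x y} → 0# ≤ k → x ≤ y → x * k ≤ y * k
  *-monoʳ-≤ 0≤k x≤y = ≤-resp-≈ (*-comm _ _) (*-comm _ _) (*-monoˡ-≤ 0≤k x≤y)

  neg-≤ : ∀ {x} → x ≤ 0# → 0# ≤ - x
  neg-≤ {x} p = ≤-by p (solve 1 (λ x → :- x :+ x := con (+ 0) :+ con (+ 0)) refl x)

  -- If 1 ≤ 0, then - 1 is nonnegative, and so is its square 1.
  0≤1 : 0# ≤ 1#
  0≤1 with total 0# 1#
  ... | inj₁ p = p
  ... | inj₂ q = ≤-by (*-nonNeg (neg-≤ q) (neg-≤ q))
    (solve 0 (con (+ 1) :+ con (+ 0) := con (+ 0) :+ (:- con (+ 1)) :* (:- con (+ 1))) refl)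

  <⇒≱ : ∀ {x y} → x < y → ¬ y ≤ x
  <⇒≱ (x≤y , x≉y) y≤x = x≉y (antisym x≤y y≤x)

  0≤+ : ∀ {x y} → 0# ≤ x → 0# ≤ y → 0# ≤ x + y
  0≤+ 0≤x 0≤y = ≤-resp-≈ (+-identityˡ 0#) refl (0≤x ⟨+⟩ 0≤y)

  0<1 : 0# < 1#
  0<1 = 0≤1 , 0≉1

  0<+ : ∀ {x y} → 0# < x → 0# ≤ y → 0# < x + y
  0<+ {x} {y} 0<x 0≤y = ≤-by (proj₁ 0<x ⟨+⟩ 0≤y)
      (solve 2 (λ x y → x :+ y :+ (con (+ 0) :+ con (+ 0)) := con (+ 0) :+ (x :+ y)) refl x y)
    , λ 0≈x+y → <⇒≱ 0<x (≤-by (≤-reflexive (sym 0≈x+y) ⟨+⟩ 0≤y)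
      (solve 2 (λ x y → con (+ 0) :+ (x :+ y :+ con (+ 0)) := x :+ (con (+ 0) :+ y)) refl x y))

  0<2 : 0# < 2#
  0<2 = 0<+ 0<1 0≤1

  0<3 : 0# < 3#
  0<3 = 0<+ 0<2 0≤1

  0≤2 = proj₁ 0<2
  0≤3 = proj₁ 0<3

  -- A nonpositive inverse y would make - (x y) = - 1 nonnegative.
  inverse⁺ : ∀ {x} → 0# < x → ∃[ y ] 0# ≤ y × x * y ≈ 1#
  inverse⁺ {x} 0<x@(0≤x , 0≉x) with inverse x (λ x≈0 → 0≉x (sym x≈0))
  ... | y , xy≈1 with total 0# y
  ...   | inj₁ 0≤y = y , 0≤y , xy≈1
  ...   | inj₂ y≤0 = ⊥-elim (0≉1 (antisym 0≤1 (≤-by (*-nonNeg 0≤x (neg-≤ y≤0)) (begin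
    0# + 0#            ≈⟨ solve 2 (λ x y → con (+ 0) :+ con (+ 0) := x :* y :+ x :* (:- y)) refl x y ⟩
    x * y + x * (- y)  ≈⟨ +-congʳ xy≈1 ⟩
    1# + x * (- y)     ∎))))

  *-cancelˡ-≈0 : ∀ {x y} → ¬ x ≈ 0# → x * y ≈ 0# → y ≈ 0#
  *-cancelˡ-≈0 {x} {y} x≉0 xy≈0 with inverse x x≉0
  ... | z , xz≈1 = begin
    y            ≈⟨ *-identityˡ y ⟨
    1# * y       ≈⟨ *-congʳ xz≈1 ⟨
    x * z * y    ≈⟨ solve 3 (λ x y z → x :* z :* y := z :* (x :* y)) refl x y z ⟩
    z * (x * y)  ≈⟨ *-congˡ xy≈0 ⟩
    z * 0#       ≈⟨ zeroʳ z ⟩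
    0#           ∎

  *-cancelˡ-≤0 : ∀ {k x} → 0# < k → k * x ≤ 0# → x ≤ 0#
  *-cancelˡ-≤0 {k} {x} 0<k kx≤0 with inverse⁺ 0<k
  ... | i , 0≤i , ki≈1 = ≤-resp-≈ (begin
    i * (k * x)  ≈⟨ solve 3 (λ i k x → i :* (k :* x) := k :* i :* x) refl i k x ⟩
    k * i * x    ≈⟨ *-congʳ ki≈1 ⟩
    1# * x       ≈⟨ *-identityˡ x ⟩
    x            ∎) (zeroʳ i) (*-monoˡ-≤ 0≤i kx≤0)

  -- Since every larger `K′` works as well, several such bounds can be met at once by the sum of
  -- their constants.
  dominate : ∀ {k} → 0# < k → ∀ a → ∃[ K ] 0# ≤ K × (∀ {K′} → K ≤ K′ → a ≤ K′ * k)
  dominate {k} 0<k@(0≤k , _) a with total 0# a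
  ... | inj₂ a≤0 = 0# , ≤-refl , λ 0≤K′ → ≤-trans a≤0 (*-nonNeg 0≤K′ 0≤k)
  ... | inj₁ 0≤a = let i , 0≤i , ki≈1 = inverse⁺ 0<k in
    a * i , *-nonNeg 0≤a 0≤i , λ ai≤K′ → ≤-trans (≤-reflexive (begin
      a            ≈⟨ *-identityʳ a ⟨
      a * 1#       ≈⟨ *-congˡ ki≈1 ⟨
      a * (k * i)  ≈⟨ solve 3 (λ a k i → a :* (k :* i) := a :* i :* k) refl a k i ⟩
      a * i * k    ∎)) (*-monoʳ-≤ 0≤k ai≤K′)

  -- Two one-sided bounds for x ≤ y avoid absolute values and can be used as summands in `≤-by`.
  Lipschitz : Carrier → (Carrier → Carrier) → Set
  Lipschitz C F = ∀ {x y} → x ≤ y → F x ≤ F y + C * (y - x) × F y ≤ F x + C * (y - x)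

  -- The zero is the supremum `s` of the points where `F` is nonnegative. Let k = 1 / C. If F s were
  -- positive, `F` would stay nonnegative up to distance k F s to the right of `s`; if F s were
  -- negative, the smaller number s + k F s would already be an upper bound.
  intermediateValue : ∀ {C lo hi} F → 0# < C → Lipschitz C F → lo ≤ hi →
                      0# ≤ F lo → F hi ≤ 0# →
                      ∃[ x ] lo ≤ x × x ≤ hi × F x ≈ 0#
  intermediateValue {C} {lo} {hi} F 0<C@(0≤C , _) lip lo≤hi 0≤Flo Fhi≤0
    with inverse⁺ 0<C
  ... | k , 0≤k , Ck≈1
    with supremum (λ x → lo ≤ x × x ≤ hi × 0# ≤ F x) (lo , ≤-refl , lo≤hi , 0≤Flo)
                  (hi , λ _ p → proj₁ (proj₂ p))
  ... | s , upper , least = s , lo≤s , s≤hi , [ nonNeg , nonPos ]′ (total 0# (F s))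
    where
    lo≤s : lo ≤ s
    lo≤s = upper lo (≤-refl , lo≤hi , 0≤Flo)
    s≤hi : s ≤ hi
    s≤hi = least hi λ _ p → proj₁ (proj₂ p)

    Ck-cancel : ∀ x → C * (k * x) ≈ x
    Ck-cancel x = begin
      C * (k * x)  ≈⟨ *-assoc C k x ⟨
      C * k * x    ≈⟨ *-congʳ Ck≈1 ⟩
      1# * x       ≈⟨ *-identityˡ x ⟩
      x            ∎

    ≤0-by-k : ∀ {x} → k * x ≤ 0# → x ≤ 0#
    ≤0-by-k {x} p = ≤-resp-≈ (Ck-cancel x) (zeroʳ C) (*-monoˡ-≤ 0≤C p)

    -- By the Lipschitz bound `F` is nonnegative at `s + h`, so `s + h` lies in the set and cannot
    -- exceed its supremum.
    step : ∀ {h} → 0# ≤ h → s + h ≤ hi → h ≤ k * F s → h ≤ 0#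
    step {h} 0≤h s+h≤hi h≤kFs = ≤-by (upper (s + h) (≤-trans lo≤s s≤s+h , s+h≤hi , ≤-by
        (proj₁ (lip s≤s+h) ⟨+⟩ *-monoˡ-≤ 0≤C h≤kFs)
        (begin
          F (s + h) + (F s + C * h)
            ≈⟨ +-congˡ (+-congʳ (Ck-cancel (F s))) ⟨
          F (s + h) + (C * (k * F s) + C * h)
            ≈⟨ solve 5 (λ Ft CkFs C h s → Ft :+ (CkFs :+ C :* h)
                 := con (+ 0) :+ (Ft :+ C :* (s :+ h :- s) :+ CkFs)) refl _ _ C h s ⟩
          0# + (F (s + h) + C * (s + h - s) + C * (k * F s)) ∎)))
      (solve 2 (λ s h → con (+ 0) :+ (s :+ h) := h :+ s) refl s h)
      where
      s≤s+h : s ≤ s + h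
      s≤s+h = ≤-by 0≤h (solve 2 (λ s h → s :+ h :+ con (+ 0) := s :+ h) refl s h)

    nonNeg : 0# ≤ F s → F s ≈ 0#
    nonNeg 0≤Fs = antisym Fs≤0 0≤Fs
      where
      Fs≤0 : F s ≤ 0#
      Fs≤0 with total (k * F s) (hi - s)
      ... | inj₁ p = ≤0-by-k (step (*-nonNeg 0≤k 0≤Fs)
              (≤-by p (solve 3 (λ a h s → h :+ a := s :+ a :+ (h :- s)) refl (k * F s) hi s)) ≤-refl)
      -- The step is cut off at `hi`. It shows hi - s ≤ 0, and the Lipschitz bound then carries F hi
      -- ≤ 0 over to `s`.
      ... | inj₂ p = ≤-by (proj₁ (lip s≤hi) ⟨+⟩ Fhi≤0 ⟨+⟩ *-monoˡ-≤ 0≤C hi-s≤0)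
              (solve 5 (λ Fs Fh C h s → con (+ 0) :+ (Fs :+ Fh :+ C :* (h :- s))
                := Fs :+ (Fh :+ C :* (h :- s) :+ con (+ 0) :+ C :* con (+ 0))) refl (F s) (F hi) C hi s)
        where
        hi-s≤0 : hi - s ≤ 0#
        hi-s≤0 = step (≤⇒0≤- s≤hi)
          (≤-reflexive (solve 2 (λ h s → s :+ (h :- s) := h) refl hi s)) p

    nonPos : F s ≤ 0# → F s ≈ 0#
    nonPos Fs≤0 = antisym Fs≤0 (≤-resp-≈ (zeroʳ C) (Ck-cancel (F s)) (*-monoˡ-≤ 0≤C 0≤kFs))
      where
      bound : ∀ x → lo ≤ x × x ≤ hi × 0# ≤ F x → x ≤ s + k * F s
      bound x p@(_ , _ , 0≤Fx) = ≤-by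
        (*-monoˡ-≤ 0≤k (≤-trans 0≤Fx (proj₁ (lip (upper x p)))))
        (begin
          s + k * F s + k * 0#
            ≈⟨ solve 4 (λ s k Fs x → s :+ k :* Fs :+ k :* con (+ 0)
                 := x :+ (k :* Fs :+ (s :- x))) refl s k (F s) x ⟩
          x + (k * F s + (s - x))
            ≈⟨ +-congˡ (+-congˡ (Ck-cancel (s - x))) ⟨
          x + (k * F s + C * (k * (s - x)))
            ≈⟨ solve 5 (λ s k Fs x C → x :+ (k :* Fs :+ C :* (k :* (s :- x)))
                 := x :+ k :* (Fs :+ C :* (s :- x))) refl s k (F s) x C ⟩
          x + k * (F s + C * (s - x)) ∎)

      0≤kFs : 0# ≤ k * F s
      0≤kFs = ≤-by (least (s + k * F s) bound)
        (solve 2 (λ a s → a :+ s := con (+ 0) :+ (s :+ a)) refl (k * F s) s)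

module FiniteSums (ℝ : CompleteOrderedField) where
  open CompleteOrderedField ℝ
  open Sum +-commutativeMonoid public
    using (sum; sum-remove; sum-cong-≋; sum-replicate-zero)

  -- Used to isolate one term of an affine dependency.
  sum-single : ∀ {n} (f : Fin n → Carrier) k → (∀ j → j ≢ k → f j ≈ 0#) → sum f ≈ f k
  sum-single {ℕ.suc n} f k others≈0 = begin
    sum f                       ≈⟨ sum-remove {i = k} f ⟩
    f k + sum (removeAt f k)    ≈⟨ +-congˡ (sum-cong-≋ λ j → others≈0 _ (Fin.punchInᵢ≢i k j)) ⟩
    f k + sum (replicate n 0#)  ≈⟨ +-congˡ (sum-replicate-zero n) ⟩
    f k + 0#                    ≈⟨ +-identityʳ _ ⟩
    f k                         ∎
    where open SetoidReasoning setoid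

-- Equilateral triangles and equidistant points

module NormedPlane (ℝ : CompleteOrderedField) (N : Plane.Norm ℝ) where
  open OrderedField ℝ
  open Plane ℝ
  open Norm N renaming (cong to ‖‖-cong)
  open SetoidReasoning setoid

  -- `abs` follows whichever side `total` chooses. If that is the side a ≤ 0, then a = 0 and the
  -- sign makes no difference.
  abs-nonNeg : ∀ {a} → 0# ≤ a → abs a ≈ a
  abs-nonNeg {a} 0≤a with total 0# a
  ... | inj₁ _   = refl
  ... | inj₂ a≤0 = begin
    - a           ≈⟨ solve 1 (λ a → :- a := a :- (a :+ a)) refl a ⟩
    a - (a + a)   ≈⟨ +-congˡ (-‿cong (+-cong a≈0 a≈0)) ⟩
    a - (0# + 0#) ≈⟨ solve 1 (λ a → a :- (con (+ 0) :+ con (+ 0)) := a) refl a ⟩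
    a             ∎
    where a≈0 = antisym a≤0 0≤a

  abs-nonPos : ∀ {a} → a ≤ 0# → abs a ≈ - a
  abs-nonPos {a} a≤0 with total 0# a
  ... | inj₂ _   = refl
  ... | inj₁ 0≤a = begin
    a              ≈⟨ solve 1 (λ a → a := (a :+ a) :- a) refl a ⟩
    (a + a) - a    ≈⟨ +-congʳ (+-cong a≈0 a≈0) ⟩
    (0# + 0#) - a  ≈⟨ solve 1 (λ a → (con (+ 0) :+ con (+ 0)) :- a := :- a) refl a ⟩
    - a            ∎
    where a≈0 = antisym a≤0 0≤a

  ‖*ₗ‖ : ∀ {a} p → 0# ≤ a → ‖ a *ₗ p ‖ ≈ a * ‖ p ‖
  ‖*ₗ‖ p 0≤a = trans (homogeneous _ p) (*-congʳ (abs-nonNeg 0≤a))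

  ‖-‖ : ∀ p → ‖ -ᴹ p ‖ ≈ ‖ p ‖
  ‖-‖ (a , b) = begin
    ‖ - a , - b ‖              ≈⟨ ‖‖-cong (-≈-1* a , -≈-1* b) ⟩
    ‖ (- 1#) *ₗ (a , b) ‖      ≈⟨ homogeneous (- 1#) (a , b) ⟩
    abs (- 1#) * ‖ a , b ‖     ≈⟨ *-congʳ (abs-nonPos -1≤0) ⟩
    - - 1# * ‖ a , b ‖         ≈⟨ solve 1 (λ x → (:- :- con (+ 1)) :* x := x) refl _ ⟩
    ‖ a , b ‖                  ∎
    where
    -≈-1* : ∀ x → - x ≈ - 1# * x
    -≈-1* = solve 1 (λ x → :- x := :- con (+ 1) :* x) refl
    -1≤0 : - 1# ≤ 0#
    -1≤0 = ≤-by 0≤1 (solve 0 (con (+ 0) :+ con (+ 0) := :- con (+ 1) :+ con (+ 1)) refl)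

  ‖*ₗ‖≤ : ∀ {a k} p → a ≤ k → - a ≤ k → ‖ a *ₗ p ‖ ≤ k * ‖ p ‖
  ‖*ₗ‖≤ {a} p a≤k -a≤k with total 0# a
  ... | inj₁ 0≤a = ≤-trans (≤-reflexive (‖*ₗ‖ p 0≤a)) (*-monoʳ-≤ (nonNegative p) a≤k)
  ... | inj₂ a≤0 = ≤-trans (≤-reflexive (trans (homogeneous _ p) (*-congʳ (abs-nonPos a≤0))))
                           (*-monoʳ-≤ (nonNegative p) -a≤k)

  -- The decomposition is an argument, so that it becomes one ring identity per coordinate for the
  -- solver.
  triangle-by : ∀ {p q r} → p ≈ᴹ q +ᴹ r → ‖ p ‖ ≤ ‖ q ‖ + ‖ r ‖
  triangle-by p≈q+r = ≤-trans (≤-reflexive (‖‖-cong p≈q+r)) (triangle _ _)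

  ‖‖-convex : ∀ {a b p q r} → 0# ≤ a → 0# ≤ b → p ≈ᴹ a *ₗ q +ᴹ b *ₗ r →
              ‖ p ‖ ≤ a * ‖ q ‖ + b * ‖ r ‖
  ‖‖-convex 0≤a 0≤b eq = ≤-trans (triangle-by eq)
    (≤-reflexive (+-cong (‖*ₗ‖ _ 0≤a) (‖*ₗ‖ _ 0≤b)))

  -- This is the reverse triangle inequality along a curve.
  lipschitz-‖‖ : ∀ {C} (γ : Carrier → Point) →
                 (∀ {x y} → x ≤ y → ‖ γ x -ᴹ γ y ‖ ≤ C * (y - x)) →
                 Lipschitz C (λ x → ‖ γ x ‖)
  lipschitz-‖‖ γ bound {x} {y} x≤y
    = ≤-trans (triangle-by (id (proj₁ (γ x)) (proj₁ (γ y)) , id (proj₂ (γ x)) (proj₂ (γ y))))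
              (≤-refl ⟨+⟩ bound x≤y)
    , ≤-trans (triangle-by (id (proj₁ (γ y)) (proj₁ (γ x)) , id (proj₂ (γ y)) (proj₂ (γ x))))
              (≤-refl ⟨+⟩ ≤-trans (≤-reflexive flip) (bound x≤y))
    where
    id : ∀ a b → a ≈ b + (a - b)
    id = solve 2 (λ a b → a := b :+ (a :- b)) refl
    flip : ‖ γ y -ᴹ γ x ‖ ≈ ‖ γ x -ᴹ γ y ‖
    flip = trans (sym (‖-‖ _)) (‖‖-cong (swap (proj₁ (γ x)) _ , swap (proj₂ (γ x)) _))
      where
      swap : ∀ a b → - (b - a) ≈ a - b
      swap = solve 2 (λ a b → :- (b :- a) := a :- b) refl

  lipschitz-- : ∀ {C D F G} → Lipschitz C F → Lipschitz D G → Lipschitz (C + D) (λ x → F x - G x)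
  lipschitz-- {C} {D} {F} {G} f g {x} {y} x≤y
    = ≤-by (proj₁ (f x≤y) ⟨+⟩ proj₂ (g x≤y)) (id _ _ _ _ C D (y - x))
    , ≤-by (proj₂ (f x≤y) ⟨+⟩ proj₁ (g x≤y)) (id _ _ _ _ C D (y - x))
    where
    id : ∀ Fx Fy Gx Gy C D z → ((Fy - Gy) + (C + D) * z) + (Fx + Gy) ≈ (Fx - Gx) + ((Fy + C * z) + (Gx + D * z))
    id = solve 7 (λ Fx Fy Gx Gy C D z → ((Fy :- Gy) :+ (C :+ D) :* z) :+ (Fx :+ Gy)
                    := (Fx :- Gx) :+ ((Fy :+ C :* z) :+ (Gx :+ D :* z))) refl

  det : Point → Point → Carrier
  det (a , b) (c , d) = a * d - b * c

  det-cong : ∀ {p p′ q q′} → p ≈ᴹ p′ → q ≈ᴹ q′ → det p q ≈ det p′ q′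
  det-cong (a , b) (c , d) = +-cong (*-cong a d) (-‿cong (*-cong b c))

  -- The triangle 0, u, v is equilateral with side L.
  record Equilateral (u v : Point) (L : Carrier) : Set where
    field
      0<L    : 0# < L
      ‖u‖    : ‖ u ‖ ≈ L
      ‖v‖    : ‖ v ‖ ≈ L
      ‖u-v‖  : ‖ u -ᴹ v ‖ ≈ L
      det≉0  : ¬ det u v ≈ 0#

  swapped : ∀ {u v L} → Equilateral u v L → Equilateral v u L
  swapped {u₁ , u₂} {v₁ , v₂} E = record
    { 0<L = 0<L ; ‖u‖ = ‖v‖ ; ‖v‖ = ‖u‖
    ; ‖u-v‖ = trans (trans (‖‖-cong (id u₁ v₁ , id u₂ v₂)) (‖-‖ _)) ‖u-v‖
    ; det≉0 = λ eq → det≉0 (begin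
        det (u₁ , u₂) (v₁ , v₂)     ≈⟨ solve 4 (λ u₁ u₂ v₁ v₂ → u₁ :* v₂ :- u₂ :* v₁ := :- (v₁ :* u₂ :- v₂ :* u₁)) refl u₁ u₂ v₁ v₂ ⟩
        - det (v₁ , v₂) (u₁ , u₂)   ≈⟨ -‿cong eq ⟩
        - 0#                        ≈⟨ solve 0 (:- con (+ 0) := con (+ 0)) refl ⟩
        0#                          ∎) }
    where
    open Equilateral E
    id : ∀ x y → y - x ≈ - (x - y)
    id = solve 2 (λ x y → y :- x := :- (x :- y)) refl

  -- The triangle is translated by - v, so that the vertex `v` takes over the role of the origin.
  rotated : ∀ {u v L} → Equilateral u v L → Equilateral (u -ᴹ v) (-ᴹ v) L
  rotated {u₁ , u₂} {v₁ , v₂} E = record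
    { 0<L = 0<L ; ‖u‖ = ‖u-v‖ ; ‖v‖ = trans (‖-‖ _) ‖v‖
    ; ‖u-v‖ = trans (‖‖-cong (id u₁ v₁ , id u₂ v₂)) ‖u‖
    ; det≉0 = λ eq → det≉0 (begin
        det (u₁ , u₂) (v₁ , v₂)     ≈⟨ solve 4 (λ u₁ u₂ v₁ v₂ → u₁ :* v₂ :- u₂ :* v₁ := :- ((u₁ :- v₁) :* (:- v₂) :- (u₂ :- v₂) :* (:- v₁))) refl u₁ u₂ v₁ v₂ ⟩
        - det ((u₁ , u₂) -ᴹ (v₁ , v₂)) (-ᴹ (v₁ , v₂))   ≈⟨ -‿cong eq ⟩
        - 0#                        ≈⟨ solve 0 (:- con (+ 0) := con (+ 0)) refl ⟩
        0#                          ∎) }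
    where
    open Equilateral E
    id : ∀ x y → (x - y) - (- y) ≈ x
    id = solve 2 (λ x y → (x :- y) :- (:- y) := x) refl

  -- The triangle inequality only gives ‖ u - 3 v ‖ ≥ 2 L.  In the case of
  -- equality, the bisector of u and v may reach the neighbourhood of 0 only along
  -- a side of the triangle (e.g. for the maximum norm).
  NonDegenerate : Point → Point → Carrier → Set
  NonDegenerate u v L = ¬ ‖ u -ᴹ 3# *ₗ v ‖ ≈ 2# * L × ¬ ‖ v -ᴹ 3# *ₗ u ‖ ≈ 2# * L

  -- Otherwise 5 v = (u + 2 v) - (u - 3 v) would have norm at most 4 L, or
  -- 7 (u - v) = 2 (3 u - 2 v) + (u - 3 v) norm at most 6 L.
  rotated-nonDegenerate : ∀ {u v L} → Equilateral u v L → ‖ u -ᴹ 3# *ₗ v ‖ ≈ 2# * L →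
                          NonDegenerate (u -ᴹ v) (-ᴹ v) L
  rotated-nonDegenerate {u@(u₁ , u₂)} {v@(v₁ , v₂)} {L} E h
    = (λ h′ → <⇒≱ 0<L (≤-by
        (≤-reflexive (sym (trans (‖*ₗ‖ v 0≤5) (*-congˡ ‖v‖)))
          ⟨+⟩ triangle-by (id₁ u₁ v₁ , id₁ u₂ v₂)
          ⟨+⟩ ≤-reflexive h′ ⟨+⟩ ≤-reflexive (trans (‖-‖ _) h))
        (solve 4 (λ L a b c → con (+ 0) :+ (con (+ 5) :* L :+ a :+ b :+ c)
           := L :+ (a :+ (b :+ c) :+ con (+ 2) :* L :+ con (+ 2) :* L)) refl L _ _ _)))
    , (λ h′ → <⇒≱ 0<L (≤-by
        (≤-reflexive (sym (trans (‖*ₗ‖ (u -ᴹ v) 0≤7) (*-congˡ ‖u-v‖)))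
          ⟨+⟩ triangle-by (id₂ u₁ v₁ , id₂ u₂ v₂)
          ⟨+⟩ ≤-reflexive (trans (‖*ₗ‖ _ 0≤2) (*-congˡ (trans (‖-‖ _) h′))) ⟨+⟩ ≤-reflexive h)
        (solve 4 (λ L a b c → con (+ 0) :+ (con (+ 7) :* L :+ a :+ b :+ c)
           := L :+ (a :+ (b :+ c) :+ con (+ 2) :* (con (+ 2) :* L) :+ con (+ 2) :* L)) refl L _ _ _)))
    where
    open Equilateral E
    5# 7# : Carrier
    5# = 1# + 1# + 1# + 1# + 1#
    7# = 5# + 1# + 1#
    0≤5 : 0# ≤ 5#
    0≤5 = proj₁ (0<+ (0<+ 0<3 0≤1) 0≤1)
    0≤7 : 0# ≤ 7#
    0≤7 = proj₁ (0<+ (0<+ (0<+ (0<+ 0<3 0≤1) 0≤1) 0≤1) 0≤1)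
    id₁ : ∀ a b → 5# * b ≈ ((a - b) - 3# * (- b)) + - (a - 3# * b)
    id₁ = solve 2 (λ a b → con (+ 5) :* b := ((a :- b) :- con (+ 3) :* (:- b)) :+ :- (a :- con (+ 3) :* b)) refl
    id₂ : ∀ a b → 7# * (a - b) ≈ 2# * (- ((- b) - 3# * (a - b))) + (a - 3# * b)
    id₂ = solve 2 (λ a b → con (+ 7) :* (a :- b) := con (+ 2) :* (:- ((:- b) :- con (+ 3) :* (a :- b))) :+ (a :- con (+ 3) :* b)) refl

  -- A degenerate vertex 0 forces one of the other vertices to be nondegenerate, so one change of
  -- origin suffices. Excluded middle decides which case holds.
  nonDegenerateEquilateral : ExcludedMiddle 0ℓ → ∀ {u v L} → Equilateral u v L →
    ∃₂ λ u v → Equilateral u v L × NonDegenerate u v L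
  nonDegenerateEquilateral em {u} {v} {L} E
    with em {P = ‖ u -ᴹ 3# *ₗ v ‖ ≈ 2# * L} | em {P = ‖ v -ᴹ 3# *ₗ u ‖ ≈ 2# * L}
  ... | yes h | _     = _ , _ , rotated E , rotated-nonDegenerate E h
  ... | no _  | yes h = _ , _ , rotated (swapped E) , rotated-nonDegenerate (swapped E) h
  ... | no h₁ | no h₂ = _ , _ , E , h₁ , h₂

  -- With ‖ u ‖ = 1 and γ tracing the line through w in direction u, the triangle
  -- 0, ‖ γ t ‖ u, γ t is equilateral at a zero of F.
  equilateral : ∃[ L ] ∃₂ λ u v → Equilateral u v L
  equilateral = n t , n t *ₗ u , γ t , record
    { 0<L   = nonNegative _ , λ 0≈n → n≉0 (sym 0≈n)
    ; ‖u‖   = trans (‖*ₗ‖ u (nonNegative _)) (trans (*-congˡ ‖u‖≈1) (*-identityʳ _))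
    ; ‖v‖   = refl
    ; ‖u-v‖ = begin
        ‖ n t *ₗ u -ᴹ γ t ‖        ≈⟨ ‖‖-cong (id₁ (n t * i) (t * i) , id₁ (n t * 0#) 1#) ⟩
        ‖ -ᴹ (γ t -ᴹ n t *ₗ u) ‖   ≈⟨ ‖-‖ _ ⟩
        ‖ γ t -ᴹ n t *ₗ u ‖        ≈⟨ solve 2 (λ a b → a := (a :- b) :+ b) refl _ (n t) ⟩
        F t + n t                  ≈⟨ +-congʳ Ft≈0 ⟩
        0# + n t                   ≈⟨ +-identityˡ _ ⟩
        n t                        ∎
    -- The determinant is `n t * i`, and neither factor is zero.
    ; det≉0 = λ eq → 0≉1 (sym (begin
        1#                         ≈⟨ mi≈1 ⟨
        m * i                      ≈⟨ *-congˡ (*-cancelˡ-≈0 n≉0 (trans (id₂ (n t) i t) eq)) ⟩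
        m * 0#                     ≈⟨ zeroʳ m ⟩
        0#                         ∎))
    }
    where
    e w : Point
    e = 1# , 0#
    w = 0# , 1#

    m : Carrier
    m = ‖ e ‖

    0<m : 0# < m
    0<m = nonNegative e , λ 0≈m → 0≉1 (sym (proj₁ (definite e (sym 0≈m))))

    inverse-m = inverse⁺ 0<m
    i = proj₁ inverse-m
    mi≈1 = proj₂ (proj₂ inverse-m)

    u : Point
    u = i , 0#

    ‖u‖≈1 : ‖ u ‖ ≈ 1#
    ‖u‖≈1 = begin
      ‖ i , 0# ‖    ≈⟨ ‖‖-cong (*-identityʳ i , zeroʳ i) ⟨
      ‖ i *ₗ e ‖    ≈⟨ ‖*ₗ‖ e (proj₁ (proj₂ inverse-m)) ⟩
      i * m         ≈⟨ *-comm i m ⟩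
      m * i         ≈⟨ mi≈1 ⟩
      1#            ∎

    γ : Carrier → Point
    γ t = t * i , 1#

    n F : Carrier → Carrier
    n t = ‖ γ t ‖
    F t = ‖ γ t -ᴹ n t *ₗ u ‖ - n t

    ‖*ₗu‖≤ : ∀ {a k} → a ≤ k → - a ≤ k → ‖ a *ₗ u ‖ ≤ k
    ‖*ₗu‖≤ a≤k -a≤k = ≤-trans (‖*ₗ‖≤ u a≤k -a≤k) (≤-reflexive (trans (*-congˡ ‖u‖≈1) (*-identityʳ _)))

    n-lipschitz : Lipschitz 1# n
    n-lipschitz = lipschitz-‖‖ γ λ {x} {y} x≤y →
      ≤-trans (≤-reflexive (‖‖-cong (
          solve 3 (λ x y i → x :* i :- y :* i := (x :- y) :* i) refl x y i ,
          solve 2 (λ x y → con (+ 1) :- con (+ 1) := (x :- y) :* con (+ 0)) refl x y)))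
        (‖*ₗu‖≤
          (≤-by (x≤y ⟨+⟩ x≤y) (solve 2 (λ x y → con (+ 1) :* (y :- x) :+ (x :+ x) := x :- y :+ (y :+ y)) refl x y))
          (≤-reflexive (solve 2 (λ x y → :- (x :- y) := con (+ 1) :* (y :- x)) refl x y)))

    -- Both `t` and `n t` change by at most y - x, hence the coefficient of `u` inside the norm by
    -- at most twice that. The subtracted `n t` contributes the remaining 1.
    F-lipschitz : Lipschitz (2# + 1#) F
    F-lipschitz = lipschitz-- (lipschitz-‖‖ (λ t → γ t -ᴹ n t *ₗ u) λ {x} {y} x≤y →
      ≤-trans (≤-reflexive (‖‖-cong (
          solve 5 (λ x y i nx ny → x :* i :- nx :* i :- (y :* i :- ny :* i) := (x :- y :- (nx :- ny)) :* i) refl x y i (n x) (n y) ,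
          solve 4 (λ x y nx ny → con (+ 1) :- nx :* con (+ 0) :- (con (+ 1) :- ny :* con (+ 0)) := (x :- y :- (nx :- ny)) :* con (+ 0)) refl x y (n x) (n y))))
        (‖*ₗu‖≤
          (≤-by (x≤y ⟨+⟩ x≤y ⟨+⟩ proj₂ (n-lipschitz x≤y)) (solve 4 (λ x y nx ny →
             con (+ 2) :* (y :- x) :+ (x :+ x :+ ny) := x :- y :- (nx :- ny) :+ (y :+ y :+ (nx :+ con (+ 1) :* (y :- x)))) refl x y (n x) (n y)))
          (≤-by (proj₁ (n-lipschitz x≤y)) (solve 4 (λ x y nx ny →
             con (+ 2) :* (y :- x) :+ nx := :- (x :- y :- (nx :- ny)) :+ (ny :+ con (+ 1) :* (y :- x))) refl x y (n x) (n y)))))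
      n-lipschitz

    -- Large enough for a sign change. At - T the vector `γ (- T) -ᴹ n (- T) *ₗ u` is - (T + n) u +
    -- w, whose norm exceeds n by at least T - ‖ w ‖. At T it is (T - n) u + w with T - n at most ‖
    -- w ‖ in absolute value, so its norm is at most 2 ‖ w ‖ = T - ‖ w ‖ ≤ n T.
    T : Carrier
    T = 3# * ‖ w ‖
    0≤T : 0# ≤ T
    0≤T = *-nonNeg 0≤3 (nonNegative w)

    ‖*ₗu‖ : ∀ {a} → 0# ≤ a → ‖ a *ₗ u ‖ ≈ a
    ‖*ₗu‖ 0≤a = trans (‖*ₗ‖ u 0≤a) (trans (*-congˡ ‖u‖≈1) (*-identityʳ _))

    0≤F[-T] : 0# ≤ F (- T)
    0≤F[-T] = ≤-by
      (≤-reflexive (sym (‖*ₗu‖ (≤-resp-≈ (+-identityˡ 0#) refl (0≤T ⟨+⟩ nonNegative (γ (- T))))))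
        ⟨+⟩ triangle-by {(T + n (- T)) *ₗ u} {w} { -ᴹ (γ (- T) -ᴹ n (- T) *ₗ u)}
          (solve 3 (λ T n i → (T :+ n) :* i := con (+ 0) :+ :- ((:- T) :* i :- n :* i)) refl T (n (- T)) i
          , solve 2 (λ T n → (T :+ n) :* con (+ 0) := con (+ 1) :+ :- (con (+ 1) :- n :* con (+ 0))) refl T (n (- T)))
        ⟨+⟩ ≤-reflexive (‖-‖ _) ⟨+⟩ nonNegative w ⟨+⟩ nonNegative w)
      (solve 5 (λ a n p x w → (a :- n) :+ (con (+ 3) :* w :+ n :+ p :+ x :+ con (+ 0) :+ con (+ 0))
         := con (+ 0) :+ (p :+ (w :+ x) :+ a :+ w :+ w)) refl
         _ (n (- T)) _ _ ‖ w ‖)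

    n≤ : n T ≤ T + ‖ w ‖
    n≤ = ≤-trans (triangle-by {γ T} {T *ₗ u} {w}
      (sym (+-identityʳ _) , solve 1 (λ T → con (+ 1) := T :* con (+ 0) :+ con (+ 1)) refl T))
      (≤-reflexive (‖*ₗu‖ 0≤T) ⟨+⟩ ≤-refl)

    ≤n : T ≤ n T + ‖ w ‖
    ≤n = ≤-by (≤-reflexive (sym (‖*ₗu‖ 0≤T)) ⟨+⟩ triangle-by {T *ₗ u} {γ T} { -ᴹ w}
      (solve 2 (λ T i → T :* i := T :* i :+ (:- con (+ 0))) refl T i
      , solve 1 (λ T → T :* con (+ 0) := con (+ 1) :+ (:- con (+ 1))) refl T)
      ⟨+⟩ ≤-reflexive (‖-‖ w))
      (solve 5 (λ n w w′ T Tu → n :+ w :+ (T :+ Tu :+ w′) := T :+ (Tu :+ (n :+ w′) :+ w)) refl (n T) ‖ w ‖ _ T _)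

    FT≤0 : F T ≤ 0#
    FT≤0 = ≤-by
      (triangle-by {γ T -ᴹ n T *ₗ u} {(T - n T) *ₗ u} {w}
        (solve 3 (λ T n i → T :* i :- n :* i := (T :- n) :* i :+ con (+ 0)) refl T (n T) i
        , solve 2 (λ T n → con (+ 1) :- n :* con (+ 0) := (T :- n) :* con (+ 0) :+ con (+ 1)) refl T (n T))
      ⟨+⟩ ‖*ₗu‖≤
        (≤-by ≤n (solve 3 (λ T n w → w :+ T := T :- n :+ (n :+ w)) refl T (n T) ‖ w ‖))
        (≤-by n≤ (solve 3 (λ T n w → w :+ n := :- (T :- n) :+ (T :+ w)) refl T (n T) ‖ w ‖))
      ⟨+⟩ ≤n)
      (solve 4 (λ a n w p → con (+ 0) :+ (a :+ p :+ con (+ 3) :* w)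
        := (a :- n) :+ (p :+ w :+ w :+ (n :+ w))) refl
        _ (n T) ‖ w ‖ _)

    root = intermediateValue F 0<3 F-lipschitz
      (≤-by (0≤T ⟨+⟩ 0≤T) (solve 1 (λ T → T :+ (con (+ 0) :+ con (+ 0)) := :- T :+ (T :+ T)) refl T))
      0≤F[-T] FT≤0
    t = proj₁ root
    Ft≈0 = proj₂ (proj₂ (proj₂ root))

    n≉0 : ¬ n t ≈ 0#
    n≉0 n≈0 = 0≉1 (sym (proj₂ (definite (γ t) n≈0)))

    id₁ : ∀ a b → a - b ≈ - (b - a)
    id₁ = solve 2 (λ a b → a :- b := :- (b :- a)) refl
    id₂ : ∀ n i t → n * i ≈ det (n *ₗ (i , 0#)) (t * i , 1#)
    id₂ = solve 3 (λ n i t → n :* i := n :* i :* con (+ 1) :- n :* con (+ 0) :* (t :* i)) refl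

  -- A point equidistant from two vertices

  module _ {u v L} (E : Equilateral u v L) where
    open Equilateral E

    -- The final triangle is 0, 3 u, 3 v. The segment parallel to a side and three times shorter
    -- then runs from `u` to `v`, and no thirds occur.
    onSide : Carrier → Point
    onSide x = (1# - x) *ₗ u +ᴹ x *ₗ v

    2L≤ : ∀ {a b} → ‖ a ‖ ≈ L → ‖ b ‖ ≈ L → 2# * L ≤ ‖ a -ᴹ 3# *ₗ b ‖
    2L≤ {a} {b} ‖a‖ ‖b‖ = ≤-by
      (≤-reflexive (sym (trans (‖*ₗ‖ b 0≤3) (*-congˡ ‖b‖)))
        ⟨+⟩ triangle-by (id (proj₁ a) (proj₁ b) , id (proj₂ a) (proj₂ b))
        ⟨+⟩ ≤-reflexive (‖-‖ _) ⟨+⟩ ≤-reflexive ‖a‖)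
      (solve 5 (λ L n b a n′ → n :+ (con (+ 3) :* L :+ b :+ n′ :+ a)
         := con (+ 2) :* L :+ (b :+ (n′ :+ a) :+ n :+ L)) refl L _ _ _ _)
      where
      id : ∀ x y → 3# * y ≈ - (x - 3# * y) + x
      id = solve 2 (λ x y → con (+ 3) :* y := :- (x :- con (+ 3) :* y) :+ x) refl

    -- At x = 0 the point is `u`, at distance 2 L from 3 u and at least 2 L from 3 v; at x = 1 the
    -- roles are exchanged. So the difference of the two distances changes sign. A zero at an end
    -- would be one of the equalities excluded by `NonDegenerate`.
    equidistantPoint : NonDegenerate u v L →
      ∃[ x ] 0# < x × x < 1# × ‖ 3# *ₗ u -ᴹ onSide x ‖ ≈ ‖ 3# *ₗ v -ᴹ onSide x ‖
    equidistantPoint (ndᵤ , ndᵥ) = x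
      , (0≤x , λ 0≈x → ndᵤ (trans (sym (Fᵥ0 (sym 0≈x))) (trans (sym Fᵤ≈Fᵥ) (Fᵤ0 (sym 0≈x)))))
      , (x≤1 , λ x≈1 → ndᵥ (trans (sym (Fᵤ1 x≈1)) (trans Fᵤ≈Fᵥ (Fᵥ1 x≈1))))
      , Fᵤ≈Fᵥ
      where
      Fᵤ Fᵥ F : Carrier → Carrier
      Fᵤ x = ‖ 3# *ₗ u -ᴹ onSide x ‖
      Fᵥ x = ‖ 3# *ₗ v -ᴹ onSide x ‖
      F x = Fᵥ x - Fᵤ x

      lipschitz : ∀ a → Lipschitz L (λ x → ‖ a -ᴹ onSide x ‖)
      lipschitz a = lipschitz-‖‖ (λ x → a -ᴹ onSide x) λ {x} {y} x≤y →
        ≤-trans (≤-reflexive (trans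
          (‖‖-cong (id x y (proj₁ a) (proj₁ u) (proj₁ v) , id x y (proj₂ a) (proj₂ u) (proj₂ v)))
          (‖-‖ _)))
        (≤-reflexive (trans (‖*ₗ‖ (u -ᴹ v) (≤⇒0≤- x≤y)) (trans (*-congˡ ‖u-v‖) (*-comm _ _))))
        where
        id : ∀ x y a u v → (a - ((1# - x) * u + x * v)) - (a - ((1# - y) * u + y * v)) ≈ - ((y - x) * (u - v))
        id = solve 5 (λ x y a u v → (a :- ((con (+ 1) :- x) :* u :+ x :* v)) :- (a :- ((con (+ 1) :- y) :* u :+ y :* v))
               := :- ((y :- x) :* (u :- v))) refl

      at0 : ∀ {x} u v → x ≈ 0# → (1# - x) * u + x * v ≈ u
      at0 {x} u v x≈0 = begin
        (1# - x) * u + x * v     ≈⟨ +-cong (*-congʳ (+-congˡ (-‿cong x≈0))) (*-congʳ x≈0) ⟩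
        (1# - 0#) * u + 0# * v   ≈⟨ solve 2 (λ u v → (con (+ 1) :- con (+ 0)) :* u :+ con (+ 0) :* v := u) refl u v ⟩
        u                        ∎
      at1 : ∀ {x} u v → x ≈ 1# → (1# - x) * u + x * v ≈ v
      at1 {x} u v x≈1 = begin
        (1# - x) * u + x * v     ≈⟨ +-cong (*-congʳ (+-congˡ (-‿cong x≈1))) (*-congʳ x≈1) ⟩
        (1# - 1#) * u + 1# * v   ≈⟨ solve 2 (λ u v → (con (+ 1) :- con (+ 1)) :* u :+ con (+ 1) :* v := v) refl u v ⟩
        v                        ∎

      flip : ∀ {x y z} → z ≈ x → y - z ≈ - (x - y)
      flip {x} {y} {z} z≈x = trans (+-congˡ (-‿cong z≈x)) (solve 2 (λ x y → y :- x := :- (x :- y)) refl x y)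

      collapse : ∀ {y z} → z ≈ y → 3# * y - z ≈ 2# * y
      collapse {y} z≈y = trans (+-congˡ (-‿cong z≈y)) (solve 1 (λ y → con (+ 3) :* y :- y := con (+ 2) :* y) refl y)

      Fᵤ0 : ∀ {x} → x ≈ 0# → Fᵤ x ≈ 2# * L
      Fᵤ0 e = trans (‖‖-cong (collapse (at0 _ _ e) , collapse (at0 _ _ e))) (trans (‖*ₗ‖ u 0≤2) (*-congˡ ‖u‖))
      Fᵥ1 : ∀ {x} → x ≈ 1# → Fᵥ x ≈ 2# * L
      Fᵥ1 e = trans (‖‖-cong (collapse (at1 _ _ e) , collapse (at1 _ _ e))) (trans (‖*ₗ‖ v 0≤2) (*-congˡ ‖v‖))
      Fᵥ0 : ∀ {x} → x ≈ 0# → Fᵥ x ≈ ‖ u -ᴹ 3# *ₗ v ‖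
      Fᵥ0 e = trans (‖‖-cong (flip (at0 _ _ e) , flip (at0 _ _ e))) (‖-‖ _)
      Fᵤ1 : ∀ {x} → x ≈ 1# → Fᵤ x ≈ ‖ v -ᴹ 3# *ₗ u ‖
      Fᵤ1 e = trans (‖‖-cong (flip (at1 _ _ e) , flip (at1 _ _ e))) (‖-‖ _)

      root = intermediateValue F (0<+ 0<L (proj₁ 0<L)) (lipschitz-- (lipschitz (3# *ₗ v)) (lipschitz (3# *ₗ u))) 0≤1
        (≤⇒0≤- (≤-resp-≈ (sym (Fᵤ0 refl)) (sym (Fᵥ0 refl)) (2L≤ ‖u‖ ‖v‖)))
        (≤-by (≤-resp-≈ (sym (Fᵥ1 refl)) (sym (Fᵤ1 refl)) (2L≤ ‖v‖ ‖u‖))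
          (solve 2 (λ a b → con (+ 0) :+ a := a :- b :+ b) refl _ _))
      x = proj₁ root
      0≤x = proj₁ (proj₂ root)
      x≤1 = proj₁ (proj₂ (proj₂ root))
      Fᵤ≈Fᵥ : Fᵤ x ≈ Fᵥ x
      Fᵤ≈Fᵥ = begin
        Fᵤ x            ≈⟨ +-identityˡ _ ⟨
        0# + Fᵤ x       ≈⟨ +-congʳ (proj₂ (proj₂ (proj₂ root))) ⟨
        F x + Fᵤ x      ≈⟨ solve 2 (λ a b → a :- b :+ b := a) refl (Fᵥ x) (Fᵤ x) ⟩
        Fᵥ x            ∎

-- Finite combinatorics

-- Pigeonhole: if `j` were missed, punching it out would inject a set of n + 1 elements into one of
-- n.
injective⇒surjective : ∀ {n} (ι : Fin n → Fin n) → Injective _≡_ _≡_ ι → ∀ j → ∃[ i ] ι i ≡ j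
injective⇒surjective {ℕ.suc n} ι ι-inj j with any? (λ i → ι i Fin.≟ j)
... | yes p = p
... | no ¬p = ⊥-elim (ℕ.1+n≰n (injective⇒≤ λ {i} {i′} eq → ι-inj
  (punchOut-injective (λ j≡ιi → ¬p (i , ≡.sym j≡ιi)) (λ j≡ιi → ¬p (i′ , ≡.sym j≡ιi)) eq)))

-- If every `j` had a preimage, choosing preimages would inject n + 1 elements into n. So some `k`
-- is missed, and after punching it out `ι` is an injection of `Fin n` into itself, hence onto.
injective⇒omitsOne : ∀ {n} (ι : Fin n → Fin (ℕ.suc n)) → Injective _≡_ _≡_ ι →
                     ∃[ k ] (∀ j → j ≢ k → ∃[ i ] ι i ≡ j)
injective⇒omitsOne {n} ι ι-inj = k , covers
  where
  image? : Decidable (λ j → ∃[ i ] ι i ≡ j)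
  image? j = any? (λ i → ι i Fin.≟ j)

  omitted : ∃[ k ] ¬ (∃[ i ] ι i ≡ k)
  omitted = ¬∀⟶∃¬ (ℕ.suc n) _ image? λ onto → ℕ.1+n≰n (injective⇒≤ {f = proj₁ ∘ onto}
    λ {j} {j′} eq → ≡.trans (≡.sym (proj₂ (onto j))) (≡.trans (≡.cong ι eq) (proj₂ (onto j′))))
  k = proj₁ omitted

  k≢ι : ∀ i → k ≢ ι i
  k≢ι i k≡ιi = proj₂ omitted (i , ≡.sym k≡ιi)

  covers : ∀ j → j ≢ k → ∃[ i ] ι i ≡ j
  covers j j≢k with injective⇒surjective (λ i → punchOut (k≢ι i))
    (λ eq → ι-inj (punchOut-injective (k≢ι _) (k≢ι _) eq)) (punchOut (j≢k ∘ ≡.sym))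
  ... | i , eq = i , punchOut-injective (k≢ι i) (j≢k ∘ ≡.sym) eq

-- Among three integers the largest difference is the sum of the other two, so equal differences
-- vanish. For four labels this is decided by going through all triples.
noThreeEquidistantLabels : ∀ (x y z : Fin 4) →
  ∣ toℕ x - toℕ y ∣ ≡ ∣ toℕ y - toℕ z ∣ → ∣ toℕ x - toℕ y ∣ ≡ ∣ toℕ x - toℕ z ∣ → x ≡ y
noThreeEquidistantLabels = from-yes (all? {4} λ x → all? {4} λ y → all? {4} λ z →
  (∣ toℕ x - toℕ y ∣ ℕ.≟ ∣ toℕ y - toℕ z ∣) →-dec
  (∣ toℕ x - toℕ y ∣ ℕ.≟ ∣ toℕ x - toℕ z ∣) →-dec (x Fin.≟ y))

-- Counting distances by a colouring of the pairs

module DistanceColouring (ℝ : CompleteOrderedField) (N : Plane.Norm ℝ) where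
  open CompleteOrderedField ℝ
  open Plane ℝ
  open Configurations N

  module _ {n k} (colour : Fin n → Fin n → Fin k) where

    -- Colours stand for distances because their equality is decidable: the pairs at a distance can
    -- be filtered out of a list and counted by evaluation.
    HasColour : Fin k → Fin n × Fin n → Set
    HasColour c (i , j) = i Fin.< j × colour i j ≡ c

    hasColour? : ∀ c → Decidable (HasColour c)
    hasColour? c (i , j) = (i Fin.<? j) ×-dec (colour i j Fin.≟ c)

    pairsOfColour : Fin k → List (Fin n × Fin n)
    pairsOfColour c = filter (hasColour? c) (cartesianProduct (allFin n) (allFin n))

  module _ {n k} {q : Fin n → Point} {δ : Fin k → Carrier} (colour : Fin n → Fin n → Fin k)
           (δ-injective : ∀ {c c′} → δ c ≈ δ c′ → c ≡ c′)
           (dist≈δ : ∀ {i j} → i Fin.< j → dist (q i) (q j) ≈ δ (colour i j)) where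

    multiplicity : ∀ c → Multiplicity q (δ c) (length (pairsOfColour colour c))
    multiplicity c = pairsOfColour colour c
      , Unique.filter⁺ (hasColour? colour c) (Unique.cartesianProduct⁺ (Unique.allFin⁺ n) (Unique.allFin⁺ n))
      , ≡.refl
      , λ { (i , j) → mk⇔
          (λ p → let i<j , eq = proj₂ (∈-filter⁻ (hasColour? colour c) {xs = cartesianProduct (allFin n) (allFin n)} p)
                 in i<j , trans (dist≈δ i<j) (reflexive (≡.cong δ eq)))
          (λ (i<j , d≈δc) → ∈-filter⁺ (hasColour? colour c)
            (∈-cartesianProduct⁺ (∈-allFin i) (∈-allFin j))
            (i<j , δ-injective (trans (sym (dist≈δ i<j)) d≈δc))) }

    determines : (∀ c → ∃[ ij ] HasColour colour c ij) → HasCardinality setoid (Determines q) k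
    determines occurs = tabulate δ , UniqueSetoid.tabulate⁺ setoid δ-injective , length-tabulate δ
      , λ d → mk⇔
          (λ d∈ → let c , d≈δc = Membership.∈-tabulate⁻ setoid d∈
                      ij , i<j , eq = occurs c
                  in ij , i<j , trans (dist≈δ i<j) (trans (reflexive (≡.cong δ eq)) (sym d≈δc)))
          (λ { ((i , j) , i<j , dist≈d) → Membership.∈-resp-≈ setoid
                 (trans (sym (dist≈δ i<j)) dist≈d) (Membership.∈-tabulate⁺ setoid (colour i j)) })

-- The crescent configuration

module CrescentConstruction (ℝ : CompleteOrderedField) (N : Plane.Norm ℝ) where
  open OrderedField ℝ
  open Plane ℝ
  open Norm N renaming (cong to ‖‖-cong)
  open Configurations N
  open NormedPlane ℝ N
  open SetoidReasoning setoid

  module _ {u v : Point} {L x : Carrier} (E : Equilateral u v L) (0<x : 0# < x) (x<1 : x < 1#)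
           (equidistant : ‖ 3# *ₗ u -ᴹ onSide E x ‖ ≈ ‖ 3# *ₗ v -ᴹ onSide E x ‖) where
    open Equilateral E

    d : Point
    d = onSide E x

    q : Fin 4 → Point
    q 0F = 3# *ₗ u
    q 1F = 3# *ₗ v
    q 2F = 0ᴹ
    q 3F = d

    u₁ = proj₁ u
    u₂ = proj₂ u
    v₁ = proj₁ v
    v₂ = proj₂ v
    s t : Carrier
    s = ‖ 3# *ₗ u -ᴹ d ‖
    t = ‖ 0ᴹ -ᴹ d ‖

    0≤1-x : 0# ≤ 1# - x
    0≤1-x = ≤⇒0≤- (proj₁ x<1)

    0<1-x : 0# < 1# - x
    0<1-x = 0≤1-x , λ 0≈1-x → <⇒≱ x<1 (≤-by (≤-reflexive (sym 0≈1-x))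
      (solve 1 (λ x → x :+ (con (+ 1) :- x) := con (+ 1) :+ con (+ 0)) refl x))

    -- Since 3 u - d = 2 u + x (u - v), the distance `s` is at most (2 + x) L, and x < 1.
    3L≰s : ¬ 3# * L ≤ s
    3L≰s 3L≤s = <⇒≱ x<1 (≤-by (*-cancelˡ-≤0 0<L (≤-by (3L≤s ⟨+⟩ ‖‖-convex 0≤2 (proj₁ 0<x) (id u₁ v₁ , id u₂ v₂)
      ⟨+⟩ ≤-reflexive (+-cong (*-congˡ ‖u‖) (*-congˡ ‖u-v‖)))
      (solve 4 (λ L s x a → con (+ 0) :+ (con (+ 3) :* L :+ s :+ a) := L :* (con (+ 1) :- x) :+ (s :+ a :+ (con (+ 2) :* L :+ x :* L))) refl L s x _)))
      (solve 1 (λ x → x :+ (con (+ 1) :- x) := con (+ 1) :+ con (+ 0)) refl x))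
      where
      id : ∀ u v → 3# * u - ((1# - x) * u + x * v) ≈ 2# * u + x * (u - v)
      id u v = solve 3 (λ x u v → con (+ 3) :* u :- ((con (+ 1) :- x) :* u :+ x :* v) := con (+ 2) :* u :+ x :* (u :- v)) refl x u v

    t≤L : t ≤ L
    t≤L = ≤-by (‖‖-convex {q = -ᴹ u} { -ᴹ v} 0≤1-x (proj₁ 0<x) (id u₁ v₁ , id u₂ v₂)
        ⟨+⟩ ≤-reflexive (+-cong (*-congˡ (trans (‖-‖ u) ‖u‖)) (*-congˡ (trans (‖-‖ v) ‖v‖))))
      (solve 4 (λ L t x a → L :+ (t :+ a) := t :+ (a :+ ((con (+ 1) :- x) :* L :+ x :* L))) refl L t x _)
      where
      id : ∀ u v → 0# - ((1# - x) * u + x * v) ≈ (1# - x) * - u + x * - v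
      id u v = solve 3 (λ x u v → con (+ 0) :- ((con (+ 1) :- x) :* u :+ x :* v) := (con (+ 1) :- x) :* (:- u) :+ x :* (:- v)) refl x u v

    -- The way from 3 u to 0 through `d` is no shorter than the side. With `t≤L` and `3L≰s` this
    -- gives t ≤ L < 2 L ≤ s < 3 L, so the three distances are different and nonzero.
    3L≤s+t : 3# * L ≤ s + t
    3L≤s+t = ≤-by (≤-reflexive (sym (trans (‖*ₗ‖ u 0≤3) (*-congˡ ‖u‖)))
        ⟨+⟩ triangle-by {3# *ₗ u} {3# *ₗ u -ᴹ d} { -ᴹ (0ᴹ -ᴹ d)} (id u₁ _ , id u₂ _) ⟨+⟩ ≤-reflexive (‖-‖ _))
      (solve 5 (λ L s t a b → (s :+ t) :+ (con (+ 3) :* L :+ a :+ b) := con (+ 3) :* L :+ (a :+ (s :+ b) :+ t)) refl L s t _ _)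
      where
      id : ∀ a b → 3# * a ≈ (3# * a - b) + - (0# - b)
      id = solve 2 (λ a b → con (+ 3) :* a := (con (+ 3) :* a :- b) :+ :- (con (+ 0) :- b)) refl

    δ : Fin 3 → Carrier
    δ 0F = 3# * L
    δ 1F = s
    δ 2F = t

    s≉t : ¬ s ≈ t
    s≉t s≈t = <⇒≱ 0<L (≤-by (3L≤s+t ⟨+⟩ ≤-reflexive s≈t ⟨+⟩ t≤L ⟨+⟩ t≤L)
      (solve 3 (λ L s t → con (+ 0) :+ (con (+ 3) :* L :+ s :+ t :+ t) := L :+ (s :+ t :+ t :+ L :+ L)) refl L s t))

    3L≉t : ¬ 3# * L ≈ t
    3L≉t 3L≈t = <⇒≱ 0<L (≤-by (≤-reflexive 3L≈t ⟨+⟩ t≤L ⟨+⟩ proj₁ 0<L)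
      (solve 2 (λ L t → con (+ 0) :+ (con (+ 3) :* L :+ t :+ con (+ 0)) := L :+ (t :+ L :+ L)) refl L t))

    δ-injective : ∀ {c c′} → δ c ≈ δ c′ → c ≡ c′
    δ-injective {0F} {0F} _ = ≡.refl
    δ-injective {1F} {1F} _ = ≡.refl
    δ-injective {2F} {2F} _ = ≡.refl
    δ-injective {0F} {1F} e = ⊥-elim (3L≰s (≤-reflexive e))
    δ-injective {1F} {0F} e = ⊥-elim (3L≰s (≤-reflexive (sym e)))
    δ-injective {0F} {2F} e = ⊥-elim (3L≉t e)
    δ-injective {2F} {0F} e = ⊥-elim (3L≉t (sym e))
    δ-injective {1F} {2F} e = ⊥-elim (s≉t e)
    δ-injective {2F} {1F} e = ⊥-elim (s≉t (sym e))

    δ≉0 : ∀ c → ¬ δ c ≈ 0#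
    δ≉0 0F e = <⇒≱ 0<L (≤-by (≤-reflexive e ⟨+⟩ proj₁ 0<L ⟨+⟩ proj₁ 0<L)
      (solve 1 (λ L → con (+ 0) :+ (con (+ 3) :* L :+ con (+ 0) :+ con (+ 0)) := L :+ (con (+ 0) :+ L :+ L)) refl L))
    δ≉0 1F e = <⇒≱ 0<L (≤-by (3L≤s+t ⟨+⟩ ≤-reflexive e ⟨+⟩ t≤L ⟨+⟩ proj₁ 0<L)
      (solve 3 (λ L s t → con (+ 0) :+ (con (+ 3) :* L :+ s :+ t :+ con (+ 0)) := L :+ (s :+ t :+ con (+ 0) :+ L :+ L)) refl L s t))
    δ≉0 2F e = 3L≰s (≤-by (3L≤s+t ⟨+⟩ ≤-reflexive e)
      (solve 3 (λ L s t → s :+ (con (+ 3) :* L :+ t) := con (+ 3) :* L :+ (s :+ t :+ con (+ 0))) refl L s t))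

    -- Only pairs with i < j count: three sides, two equal distances to `d`, and the distance from 0
    -- to `d`. The other values are fillers.
    colour : Fin 4 → Fin 4 → Fin 3
    colour 2F 3F = 2F
    colour _  3F = 1F
    colour _  _  = 0F

    dist≈δ : ∀ {i j} → i Fin.< j → dist (q i) (q j) ≈ δ (colour i j)
    dist≈δ {0F} {1F} _ = trans (‖‖-cong (id u₁ v₁ , id u₂ v₂)) (trans (‖*ₗ‖ (u -ᴹ v) 0≤3) (*-congˡ ‖u-v‖))
      where
      id : ∀ a b → 3# * a - 3# * b ≈ 3# * (a - b)
      id = solve 2 (λ a b → con (+ 3) :* a :- con (+ 3) :* b := con (+ 3) :* (a :- b)) refl
    dist≈δ {0F} {2F} _ = trans (‖‖-cong (id u₁ , id u₂)) (trans (‖*ₗ‖ u 0≤3) (*-congˡ ‖u‖))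
      where
      id : ∀ a → 3# * a - 0# ≈ 3# * a
      id = solve 1 (λ a → con (+ 3) :* a :- con (+ 0) := con (+ 3) :* a) refl
    dist≈δ {1F} {2F} _ = trans (‖‖-cong (id v₁ , id v₂)) (trans (‖*ₗ‖ v 0≤3) (*-congˡ ‖v‖))
      where
      id : ∀ a → 3# * a - 0# ≈ 3# * a
      id = solve 1 (λ a → con (+ 3) :* a :- con (+ 0) := con (+ 3) :* a) refl
    dist≈δ {0F} {3F} _ = refl
    dist≈δ {1F} {3F} _ = sym equidistant
    dist≈δ {2F} {3F} _ = refl
    dist≈δ {0F} {0F} ()
    dist≈δ {suc _} {0F} ()
    dist≈δ {suc _} {1F} (s≤s ())
    dist≈δ {suc (suc _)} {2F} (s≤s (s≤s ()))
    dist≈δ {suc (suc (suc _))} {3F} (s≤s (s≤s (s≤s ())))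

    open DistanceColouring ℝ N

    occurs : ∀ c → ∃[ ij ] HasColour colour c ij
    occurs 0F = (0F , 1F) , s≤s z≤n , ≡.refl
    occurs 1F = (0F , 3F) , s≤s z≤n , ≡.refl
    occurs 2F = (2F , 3F) , s≤s (s≤s (s≤s z≤n)) , ≡.refl

    multiplicities : ∀ i → 1 ℕ.≤ i → i ℕ.≤ 3 → ∃[ d ] Multiplicity q d i
    -- The lists `pairsOfColour` evaluate to lengths 1, 2 and 3.
    multiplicities 1 _ _ = t , multiplicity colour δ-injective dist≈δ 2F
    multiplicities 2 _ _ = s , multiplicity colour δ-injective dist≈δ 1F
    multiplicities 3 _ _ = 3# * L , multiplicity colour δ-injective dist≈δ 0F
    multiplicities (ℕ.suc (ℕ.suc (ℕ.suc (ℕ.suc _)))) _ (s≤s (s≤s (s≤s ())))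

    dist≈0 : ∀ {a b} → a ≈ᴹ b → dist a b ≈ 0#
    dist≈0 {a} {b} (e₁ , e₂) = trans (‖‖-cong (id e₁ , id e₂)) (trans (‖*ₗ‖ b ≤-refl) (zeroˡ _))
      where
      id : ∀ {x y} → x ≈ y → x - y ≈ 0# * y
      id {x} {y} x≈y = trans (+-congʳ x≈y) (solve 1 (λ y → y :- y := con (+ 0) :* y) refl y)

    distinct : Distinct q
    distinct {i} {j} (e₁ , e₂) with Fin.<-cmp i j
    ... | tri≈ _ i≡j _ = i≡j
    ... | tri< i<j _ _ = ⊥-elim (δ≉0 (colour i j) (trans (sym (dist≈δ i<j)) (dist≈0 (e₁ , e₂))))
    ... | tri> _ _ j<i = ⊥-elim (δ≉0 (colour j i) (trans (sym (dist≈δ j<i)) (dist≈0 (sym e₁ , sym e₂))))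

    -- All four points occur, among them the three vertices. Their labels would be pairwise
    -- equidistant, so two of them would coincide.
    notLineLike : NoSubfamily 4 LineLike q
    notLineLike ι ι-inj (_ , φ , preserves) = 0≢1
      (≡.trans (≡.sym (proj₂ (onto 0F))) (≡.trans (≡.cong ι (Injection.injective (↔⇒↣ φ) φa≡φb)) (proj₂ (onto 1F))))
      where
      onto = injective⇒surjective ι ι-inj
      a b c : Fin 4
      a = proj₁ (onto 0F)
      b = proj₁ (onto 1F)
      c = proj₁ (onto 2F)

      0≢1 : ¬ _≡_ {A = Fin 4} 0F 1F
      0≢1 ()

      side : ∀ {i j i′ j′} → ι i ≡ i′ → ι j ≡ j′ → dist (q i′) (q j′) ≈ 3# * L → dist (q (ι i)) (q (ι j)) ≈ 3# * L
      side ≡.refl ≡.refl eq = eq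

      ab : dist (q (ι a)) (q (ι b)) ≈ 3# * L
      ab = side (proj₂ (onto 0F)) (proj₂ (onto 1F)) (dist≈δ {0F} {1F} (s≤s z≤n))
      bc : dist (q (ι b)) (q (ι c)) ≈ 3# * L
      bc = side (proj₂ (onto 1F)) (proj₂ (onto 2F)) (dist≈δ {1F} {2F} (s≤s (s≤s z≤n)))
      ac : dist (q (ι a)) (q (ι c)) ≈ 3# * L
      ac = side (proj₂ (onto 0F)) (proj₂ (onto 2F)) (dist≈δ {0F} {2F} (s≤s z≤n))

      φa≡φb : φ ⟨$⟩ʳ a ≡ φ ⟨$⟩ʳ b
      φa≡φb = noThreeEquidistantLabels _ _ (φ ⟨$⟩ʳ c)
        (Equivalence.to (preserves a b b c) (trans ab (sym bc)))
        (Equivalence.to (preserves a b a c) (trans ab (sym ac)))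

    -- The coefficients of an affine dependency of the four points.
    weight : Fin 4 → Carrier
    weight 0F = 1# - x
    weight 1F = x
    weight 2F = 2#
    weight 3F = - 3#

    weight≉0 : ∀ j → ¬ weight j ≈ 0#
    weight≉0 0F e = proj₂ 0<1-x (sym e)
    weight≉0 1F e = proj₂ 0<x (sym e)
    weight≉0 2F e = proj₂ 0<2 (sym e)
    weight≉0 3F e = proj₂ 0<3 (begin
      0#      ≈⟨ solve 0 (con (+ 0) := :- con (+ 0)) refl ⟩
      - 0#    ≈⟨ -‿cong e ⟨
      - - 3#  ≈⟨ solve 0 (:- :- con (+ 3) := con (+ 3)) refl ⟩
      3#      ∎)

    open FiniteSums ℝ

    -- The affine function `ℓ` of the line vanishes at three of the points. All coefficients of the
    -- affine dependency are nonzero, so it vanishes at the fourth as well. Comparing its values at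
    -- 0, 3 u and 3 v then gives U = V = 0.
    noThreeCollinear : NoSubfamily 3 Collinear q
    noThreeCollinear ι ι-inj (p@(p₁ , p₂) , z@(z₁ , z₂) , z≉0 , on) =
      -- Cramer's rule: `det u v` times z equals U v - V u.
      z≉0 (*-cancelˡ-≈0 det≉0 (vanishes (solve 6 (λ u₁ u₂ v₁ v₂ z₁ z₂ → (u₁ :* v₂ :- u₂ :* v₁) :* z₁
             := v₁ :* (u₁ :* z₂ :- u₂ :* z₁) :- u₁ :* (v₁ :* z₂ :- v₂ :* z₁)) refl u₁ u₂ v₁ v₂ z₁ z₂))
         , *-cancelˡ-≈0 det≉0 (vanishes (solve 6 (λ u₁ u₂ v₁ v₂ z₁ z₂ → (u₁ :* v₂ :- u₂ :* v₁) :* z₂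
             := v₂ :* (u₁ :* z₂ :- u₂ :* z₁) :- u₂ :* (v₁ :* z₂ :- v₂ :* z₁)) refl u₁ u₂ v₁ v₂ z₁ z₂)))
      where
      -- Vanishes exactly on the line through p with direction z.
      ℓ : Point → Carrier
      ℓ a = det (a -ᴹ p) z

      U V P : Carrier
      U = det u z
      V = det v z
      P = det p z

      ℓ-ι : ∀ i → ℓ (q (ι i)) ≈ 0#
      ℓ-ι i = let r , e₁ , e₂ = on i in trans
        (det-cong {q = z} (+-congʳ e₁ , +-congʳ e₂) (refl , refl))
        (solve 5 (λ p₁ p₂ r z₁ z₂ → (p₁ :+ r :* z₁ :- p₁) :* z₂ :- (p₂ :+ r :* z₂ :- p₂) :* z₁ := con (+ 0)) refl p₁ p₂ r z₁ z₂)

      ℓ-multiple : ∀ a → ℓ (3# *ₗ a) ≈ 3# * det a z - P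
      ℓ-multiple (a₁ , a₂) = solve 6 (λ a₁ a₂ p₁ p₂ z₁ z₂ →
        (con (+ 3) :* a₁ :- p₁) :* z₂ :- (con (+ 3) :* a₂ :- p₂) :* z₁
        := con (+ 3) :* (a₁ :* z₂ :- a₂ :* z₁) :- (p₁ :* z₂ :- p₂ :* z₁)) refl a₁ a₂ p₁ p₂ z₁ z₂

      ℓ-0 : ℓ 0ᴹ ≈ - P
      ℓ-0 = solve 4 (λ p₁ p₂ z₁ z₂ → (con (+ 0) :- p₁) :* z₂ :- (con (+ 0) :- p₂) :* z₁
        := :- (p₁ :* z₂ :- p₂ :* z₁)) refl p₁ p₂ z₁ z₂

      ℓ-d : ℓ d ≈ (1# - x) * U + x * V - P
      ℓ-d = solve 9 (λ x u₁ u₂ v₁ v₂ p₁ p₂ z₁ z₂ →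
        ((con (+ 1) :- x) :* u₁ :+ x :* v₁ :- p₁) :* z₂ :- ((con (+ 1) :- x) :* u₂ :+ x :* v₂ :- p₂) :* z₁
        := (con (+ 1) :- x) :* (u₁ :* z₂ :- u₂ :* z₁) :+ x :* (v₁ :* z₂ :- v₂ :* z₁) :- (p₁ :* z₂ :- p₂ :* z₁))
        refl x u₁ u₂ v₁ v₂ p₁ p₂ z₁ z₂

      dependency : sum (λ j → weight j * ℓ (q j)) ≈ 0#
      dependency = begin
        sum (λ j → weight j * ℓ (q j))
          ≈⟨ +-cong (*-congˡ (ℓ-multiple u)) (+-cong (*-congˡ (ℓ-multiple v)) (+-cong (*-congˡ ℓ-0) (+-congʳ (*-congˡ ℓ-d)))) ⟩
        (1# - x) * (3# * U - P) + (x * (3# * V - P) + (2# * - P + (- 3# * ((1# - x) * U + x * V - P) + 0#)))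
          ≈⟨ solve 4 (λ x U V P → (con (+ 1) :- x) :* (con (+ 3) :* U :- P) :+ (x :* (con (+ 3) :* V :- P) :+ (con (+ 2) :* (:- P)
               :+ ((:- con (+ 3)) :* ((con (+ 1) :- x) :* U :+ x :* V :- P) :+ con (+ 0)))) := con (+ 0)) refl x U V P ⟩
        0# ∎

      k = proj₁ (injective⇒omitsOne ι ι-inj)

      ℓ-others : ∀ j → j ≢ k → ℓ (q j) ≈ 0#
      ℓ-others j j≢k = let i , ιi≡j = proj₂ (injective⇒omitsOne ι ι-inj) j j≢k
                       in ≡.subst (λ j → ℓ (q j) ≈ 0#) ιi≡j (ℓ-ι i)

      ℓ-all : ∀ j → ℓ (q j) ≈ 0#
      ℓ-all j with j Fin.≟ k
      ... | no j≢k     = ℓ-others j j≢k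
      ... | yes ≡.refl = *-cancelˡ-≈0 (weight≉0 k) (trans
        (sym (sum-single (λ j → weight j * ℓ (q j)) k λ j j≢k → trans (*-congˡ (ℓ-others j j≢k)) (zeroʳ _)))
        dependency)

      multiple≈0 : ∀ a → ℓ (3# *ₗ a) ≈ 0# → det a z ≈ 0#
      multiple≈0 a e = *-cancelˡ-≈0 (λ 3≈0 → proj₂ 0<3 (sym 3≈0)) (begin
        3# * det a z              ≈⟨ solve 2 (λ a P → a := a :- P :- (:- P)) refl (3# * det a z) P ⟩
        3# * det a z - P - - P    ≈⟨ +-cong (ℓ-multiple a) (-‿cong ℓ-0) ⟨
        ℓ (3# *ₗ a) - ℓ 0ᴹ        ≈⟨ +-cong e (-‿cong (ℓ-all 2F)) ⟩
        0# - 0#                   ≈⟨ -‿inverseʳ 0# ⟩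
        0#                        ∎)

      vanishes : ∀ {a b c} → a ≈ b * U - c * V → a ≈ 0#
      vanishes {a} {b} {c} e = begin
        a                ≈⟨ e ⟩
        b * U - c * V    ≈⟨ +-cong (*-congˡ (multiple≈0 u (ℓ-all 0F))) (-‿cong (*-congˡ (multiple≈0 v (ℓ-all 1F)))) ⟩
        b * 0# - c * 0#  ≈⟨ solve 2 (λ b c → b :* con (+ 0) :- c :* con (+ 0) := con (+ 0)) refl b c ⟩
        0#               ∎

    -- Cramer's rule in the basis `u`, `v`.
    coordinates : ∀ p → ∃₂ λ y z → p ≈ᴹ y *ₗ u +ᴹ z *ₗ v
    coordinates p@(p₁ , p₂) =
      i * det p v , i * det u p
      , scale p₁ (solve 7 (λ i u₁ u₂ v₁ v₂ p₁ p₂ → (u₁ :* v₂ :- u₂ :* v₁) :* i :* p₁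
          := i :* (p₁ :* v₂ :- p₂ :* v₁) :* u₁ :+ i :* (u₁ :* p₂ :- u₂ :* p₁) :* v₁) refl i u₁ u₂ v₁ v₂ p₁ p₂)
      , scale p₂ (solve 7 (λ i u₁ u₂ v₁ v₂ p₁ p₂ → (u₁ :* v₂ :- u₂ :* v₁) :* i :* p₂
          := i :* (p₁ :* v₂ :- p₂ :* v₁) :* u₂ :+ i :* (u₁ :* p₂ :- u₂ :* p₁) :* v₂) refl i u₁ u₂ v₁ v₂ p₁ p₂)
      where
      i = proj₁ (inverse (det u v) det≉0)
      Di≈1 = proj₂ (inverse (det u v) det≉0)
      scale : ∀ {b} a → det u v * i * a ≈ b → a ≈ b
      scale a e = trans (sym (*-identityˡ a)) (trans (*-congʳ (sym Di≈1)) e)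

    -- Writing p = y u + z v, one sees that for large K the point d + (d - p) / (K - 1)
    -- lies in the triangle 3u, 3v, 0, although its distance from p is K r / (K - 1) > r.
    noFourConcyclic : NoSubfamily 4 Concyclic q
    noFourConcyclic ι ι-inj (p , r , 0<r , on) = <⇒≱ 0<r (*-cancelˡ-≤0 0<3 (≤-by
      -- The vector 3 K (d - p) is a combination of the vectors from p to the vertices, with
      -- nonnegative coefficients of sum 3 K - 3. Hence 3 K r ≤ (3 K - 3) r, that is, 3 r ≤ 0.
      (≤-reflexive (sym (trans (‖*ₗ‖ (d -ᴹ p′) 0≤3K) (*-congˡ (on′ 3F))))
        ⟨+⟩ triangle-by {r = C *ₗ (0ᴹ -ᴹ p′)} (id u₁ v₁ , id u₂ v₂)
        ⟨+⟩ triangle (A *ₗ (3# *ₗ u -ᴹ p′)) (B *ₗ (3# *ₗ v -ᴹ p′))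
        ⟨+⟩ ≤-reflexive (trans (‖*ₗ‖ _ 0≤A) (*-congˡ (on′ 0F)))
        ⟨+⟩ ≤-reflexive (trans (‖*ₗ‖ _ 0≤B) (*-congˡ (on′ 1F)))
        ⟨+⟩ ≤-reflexive (trans (‖*ₗ‖ _ 0≤C) (*-congˡ (on′ 2F))))
      (solve 10 (λ K r x y z a b c d e → con (+ 0) :+ (con (+ 3) :* K :* r :+ a :+ b :+ c :+ d :+ e)
         := con (+ 3) :* r :+ (a :+ (b :+ e) :+ (c :+ d) :+ (K :* (con (+ 1) :- x) :- y) :* r :+ (K :* x :- z) :* r
              :+ (K :* con (+ 2) :- (con (+ 3) :- y :- z)) :* r)) refl K r x y z _ _ _ _ _)))
      where
      y z : Carrier
      y = proj₁ (coordinates p)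
      z = proj₁ (proj₂ (coordinates p))

      p′ : Point
      p′ = y *ₗ u +ᴹ z *ₗ v

      on′ : ∀ j → dist (q j) p′ ≈ r
      on′ j = let i , ιi≡j = injective⇒surjective ι ι-inj j
                  p≈p′ = proj₂ (proj₂ (coordinates p)) in
        trans (‖‖-cong (+-congˡ (-‿cong (sym (proj₁ p≈p′))) , +-congˡ (-‿cong (sym (proj₂ p≈p′)))))
              (≡.subst (λ j → dist (q j) p ≈ r) ιi≡j (on i))

      dominateᵤ = dominate 0<1-x y
      dominateᵥ = dominate 0<x z
      dominate₀ = dominate 0<2 (3# - y - z)
      Kᵤ Kᵥ K₀ K : Carrier
      Kᵤ = proj₁ dominateᵤ
      Kᵥ = proj₁ dominateᵥ
      K₀ = proj₁ dominate₀
      K  = Kᵤ + Kᵥ + K₀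

      0≤Kᵤ = proj₁ (proj₂ dominateᵤ)
      0≤Kᵥ = proj₁ (proj₂ dominateᵥ)
      0≤K₀ = proj₁ (proj₂ dominate₀)

      0≤3K : 0# ≤ 3# * K
      0≤3K = *-nonNeg 0≤3 (0≤+ (0≤+ 0≤Kᵤ 0≤Kᵥ) 0≤K₀)

      -- The terms with `K` come from the affine dependency, which expresses 3 K (d - p) by the
      -- vertices. The subtracted y, z, 3 - y - z are three times the barycentric coordinates of p,
      -- so their combination of the vectors from p to the vertices is zero.
      A B C : Carrier
      A = K * (1# - x) - y
      B = K * x - z
      C = K * 2# - (3# - y - z)

      0≤A : 0# ≤ A
      0≤A = ≤⇒0≤- (proj₂ (proj₂ dominateᵤ) (≤-by (0≤Kᵥ ⟨+⟩ 0≤K₀)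
        (solve 3 (λ a b c → a :+ b :+ c :+ (con (+ 0) :+ con (+ 0)) := a :+ (b :+ c)) refl Kᵤ Kᵥ K₀)))
      0≤B : 0# ≤ B
      0≤B = ≤⇒0≤- (proj₂ (proj₂ dominateᵥ) (≤-by (0≤Kᵤ ⟨+⟩ 0≤K₀)
        (solve 3 (λ a b c → a :+ b :+ c :+ (con (+ 0) :+ con (+ 0)) := b :+ (a :+ c)) refl Kᵤ Kᵥ K₀)))
      0≤C : 0# ≤ C
      0≤C = ≤⇒0≤- (proj₂ (proj₂ dominate₀) (≤-by (0≤Kᵤ ⟨+⟩ 0≤Kᵥ)
        (solve 3 (λ a b c → a :+ b :+ c :+ (con (+ 0) :+ con (+ 0)) := c :+ (a :+ b)) refl Kᵤ Kᵥ K₀)))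

      id : ∀ u v → 3# * K * ((1# - x) * u + x * v - (y * u + z * v))
         ≈ A * (3# * u - (y * u + z * v)) + B * (3# * v - (y * u + z * v)) + C * (0# - (y * u + z * v))
      id u v = solve 6 (λ K x y z u v → con (+ 3) :* K :* ((con (+ 1) :- x) :* u :+ x :* v :- (y :* u :+ z :* v))
        := (K :* (con (+ 1) :- x) :- y) :* (con (+ 3) :* u :- (y :* u :+ z :* v)) :+ (K :* x :- z) :* (con (+ 3) :* v :- (y :* u :+ z :* v))
           :+ (K :* con (+ 2) :- (con (+ 3) :- y :- z)) :* (con (+ 0) :- (y :* u :+ z :* v))) refl K x y z u v

    strongCrescent : StrongCrescent q
    strongCrescent = record
      { distinct              = distinct
      ; strongGeneralPosition = record
        { noThreeCollinear = noThreeCollinear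
        ; noFourConcyclic  = noFourConcyclic
        ; noFourLineLike   = notLineLike
        }
      ; distances      = determines colour δ-injective dist≈δ occurs
      ; multiplicities = multiplicities
      }

theorem1p6 : ExcludedMiddle 0ℓ → (ℝ : CompleteOrderedField) → let open Plane ℝ in
    (N : Norm) → let open Configurations N in
    Σ[ q ∈ (Fin 4 → Point) ] StrongCrescent q
theorem1p6 em ℝ N =
  let _ , _ , _ , E₀               = equilateral
      _ , _ , E , nonDegenerate    = nonDegenerateEquilateral em E₀
      _ , 0<x , x<1 , equidistant  = equidistantPoint E nonDegenerate
  in q E 0<x x<1 equidistant , strongCrescent E 0<x x<1 equidistant
  where
  open NormedPlane ℝ N
  open CrescentConstruction ℝ N
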